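{- Let $n\ge0$ be an integer. (a) If $n$ is even (resp. odd), there exists a magic-faced folded hypercube (resp. magic-faced hierarchical folded hypercube) $A_n$ of dimension $n$, which is unique up to the action of $\mathrm{Aut}(FQ_n)$ (resp. $\mathrm{Aut}(HFQ_n)$), i.e. up to automorphisms of the underlying graph. (b) Magic-faced hypercubes of dimension $n$ are in one-to-one correspondence with graph embeddings $\phi:Q_n\hookrightarrow FQ_n$ if $n$ is even, and with graph embeddings $\phi:Q_n\hookrightarrow HFQ_n$ if $n$ is odd. Given such an embedding $\phi$, the corresponding magic-faced hypercube is the one in which the label of a vertex $v\in Q_n$ is $A_n(\phi(v))$.
   Context: $Q_n$ is the hypercube graph on vertex set $\{0,1\}^n$ (two vertices adjacent iff they differ in exactly one coordinate). A magic-faced hypercube of dimension $n$ is a bijective labeling of the vertices of $Q_n$ by $1,\ldots,2^n$ such that every $4$-cycle of $Q_n$ (equivalently, every $2\times2$ face of the $2\times\cdots\times2$ array) has the same sum of labels. The folded hypercube graph $FQ_n$ is $Q_n$ together with an additional edge joining each pair of antipodal vertices (vertices differing in all $n$ coordinates); $FQ_0$ is a single vertex. For $n\ge1$, the hierarchical folded hypercube graph is $HFQ_n:=K_2\times FQ_{n-1}$ (Cartesian product of graphs). A magic-faced folded hypercube (resp. magic-faced hierarchical folded hypercube) of dimension $n$ is a bijective labeling of the vertices of $FQ_n$ (resp. $HFQ_n$) by the integers $1,\ldots,2^n$ such that the labels on every $4$-cycle of $FQ_n$ (resp. $HFQ_n$) have the same sum. Graph automorphisms act on labelings by permuting vertices.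 A graph embedding is an injective map on vertices sending edges to edges (not necessarily induced). -}

module Defs where

open import Data.Bool.Base using (Bool)
open import Data.Fin.Base using (Fin; toℕ)
open import Data.Nat.Base using (ℕ; suc; _+_; _^_; NonZero)
open import Data.Product using (_×_; _,_; ∃!; Σ-syntax)
open import Data.Sum.Base using (_⊎_; inj₁; inj₂)
open import Data.Vec.Base using (Vec; lookup)
open import Function.Bundles using (Bijection; _⤖_; _⇔_)
open import Function.Definitions using (Injective)
open import Level using (0ℓ)
open import Relation.Binary.Bundles using (Setoid)
open import Relation.Binary.Core using (Rel)
open import Relation.Binary.Definitions using (Symmetric; Irreflexive)
import Relation.Binary.Construct.On as On
open import Relation.Binary.PropositionalEquality
  using (_≡_; _≢_; refl; sym; ≢-sym; _→-setoid_)

record Graph : Set₁ where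
  infix 4 _~_
  field
    Vertex   : Set
    _~_      : Rel Vertex 0ℓ
    ~-sym    : Symmetric _~_
    ~-irrefl : Irreflexive _≡_ _~_

open Graph using (Vertex)

K₂ : Graph
K₂ = record
  { Vertex   = Bool
  ; _~_      = _≢_
  ; ~-sym    = ≢-sym
  ; ~-irrefl = λ x≡y x≢y → x≢y x≡y
  }

infixr 7 _□_

-- Cartesian product of graphs.
_□_ : Graph → Graph → Graph
G □ H = record
  { Vertex   = Vertex G × Vertex H
  ; _~_      = λ (u , x) (v , y) → (u G.~ v × x ≡ y) ⊎ (u ≡ v × x H.~ y)
  ; ~-sym    = λ { (inj₁ (u~v , x≡y)) → inj₁ (G.~-sym u~v , sym x≡y)
                 ; (inj₂ (u≡v , x~y)) → inj₂ (sym u≡v , H.~-sym x~y) }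
  ; ~-irrefl = λ { refl (inj₁ (u~u , _)) → G.~-irrefl refl u~u
                 ; refl (inj₂ (_ , x~x)) → H.~-irrefl refl x~x }
  }
  where
  module G = Graph G
  module H = Graph H

module _ {n : ℕ} where

  DiffersAt : Vec Bool n → Vec Bool n → Fin n → Set
  DiffersAt u v i = lookup u i ≢ lookup v i

  DifferInExactlyOne : Rel (Vec Bool n) 0ℓ
  DifferInExactlyOne u v = ∃! _≡_ (DiffersAt u v)

  Antipodal : Rel (Vec Bool n) 0ℓ
  Antipodal u v = ∀ i → DiffersAt u v i

  one-sym : Symmetric DifferInExactlyOne
  one-sym (i , d , unique) = i , ≢-sym d , λ e → unique (≢-sym e)

  one-irrefl : Irreflexive _≡_ DifferInExactlyOne
  one-irrefl refl (_ , d , _) = d refl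

Q : ℕ → Graph
Q n = record
  { Vertex   = Vec Bool n
  ; _~_      = DifferInExactlyOne
  ; ~-sym    = λ {u} {v} → one-sym {x = u} {y = v}
  ; ~-irrefl = one-irrefl
  }

-- The condition u ≢ v matters only for n = 0, where the single vertex is
-- vacuously antipodal to itself.
FQ : ℕ → Graph
FQ n = record
  { Vertex   = Vec Bool n
  ; _~_      = λ u v → DifferInExactlyOne u v ⊎ (u ≢ v × Antipodal u v)
  ; ~-sym    = λ { {u} {v} (inj₁ d) → inj₁ (one-sym {x = u} {y = v} d)
                 ; (inj₂ (u≢v , a))   → inj₂ (≢-sym u≢v , λ i → ≢-sym (a i)) }
  ; ~-irrefl = λ { u≡v (inj₁ d)         → one-irrefl u≡v d
                 ; u≡v (inj₂ (u≢v , _)) → u≢v u≡v }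
  }

HFQ : (n : ℕ) → .{{_ : NonZero n}} → Graph
HFQ (suc m) = K₂ □ FQ m

-- Adjacent vertices are distinct by irreflexivity, so only the two diagonals
-- need explicit distinctness.
record FourCycle (G : Graph) : Set where
  open Graph G using (_~_)
  field
    a b c d : Vertex G
    a~b     : a ~ b
    b~c     : b ~ c
    c~d     : c ~ d
    d~a     : d ~ a
    a≢c     : a ≢ c
    b≢d     : b ≢ d

sumAround : {G : Graph} → (Vertex G → ℕ) → FourCycle G → ℕ
sumAround f C = f a + f b + f c + f d
  where open FourCycle C

-- A bijective labelling by 1, …, 2 ^ n; the label 1 + k is encoded by the
-- element k of Fin (2 ^ n).
record MagicLabelling (G : Graph) (n : ℕ) : Set where
  field
    labelling : Vertex G ⤖ Fin (2 ^ n)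

  label : Vertex G → ℕ
  label v = suc (toℕ (Bijection.to labelling v))

  field
    magic : (C C′ : FourCycle G) → sumAround label C ≡ sumAround label C′

open MagicLabelling public using (label)

record Automorphism (G : Graph) : Set where
  open Graph G using (_~_)
  field
    bijection : Vertex G ⤖ Vertex G

  map : Vertex G → Vertex G
  map = Bijection.to bijection

  field
    preserves : ∀ u v → (u ~ v) ⇔ (map u ~ map v)

-- B is the image of A under the automorphism that moves each vertex,
-- carrying its label along.
SameOrbit : ∀ {G n} → MagicLabelling G n → MagicLabelling G n → Set
SameOrbit {G} A B =
  Σ[ σ ∈ Automorphism G ] (∀ v → label B (Automorphism.map σ v) ≡ label A v)

record Embedding (G H : Graph) : Set where
  private
    module G = Graph G
    module H = Graph H
  field
    map       : G.Vertex → H.Vertex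
    injective : Injective _≡_ _≡_ map
    edge      : ∀ {u v} → u G.~ v → map u H.~ map v

-- Labellings and embeddings are compared by their underlying functions,
-- pointwise, ignoring the proof components.
magicSetoid : Graph → ℕ → Setoid 0ℓ 0ℓ
magicSetoid G n = On.setoid {B = MagicLabelling G n} (Vertex G →-setoid ℕ) label

embeddingSetoid : Graph → Graph → Setoid 0ℓ 0ℓ
embeddingSetoid G H =
  On.setoid {B = Embedding G H} (Vertex G →-setoid Vertex H) Embedding.map

ExistsUniqueUpToAut : Graph → ℕ → Set
ExistsUniqueUpToAut G n =
  Σ[ A ∈ MagicLabelling G n ] (∀ (B : MagicLabelling G n) → SameOrbit A B)

EmbeddingCorrespondence : (G : Graph) (n : ℕ) → MagicLabelling G n → Set
EmbeddingCorrespondence G n A =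
  Σ[ β ∈ Bijection (embeddingSetoid (Q n) G) (magicSetoid (Q n) n) ]
    (∀ φ v → label (Bijection.to β φ) v ≡ label A (Embedding.map φ v))

{-# OPTIONS --safe #-}

-- Let H n be the graph on binary words in which distinct words are adjacent when
-- they agree in at most one place. Labelling a word by 1 + its binary value is
-- magic: in a four-cycle no three consecutive words agree in a place, so each
-- place contributes exactly two ones. Conversely, sending a vertex of Q n to the
-- binary word of its label embeds Q n into H n for every magic labelling: up to a
-- translation, complementing the labels at odd vertices makes them additive, so
-- the labels are subset sums of n + 1 weights, the vertex of maximal label forces
-- one weight to vanish, and the remaining n weights have the subset sums
-- 0, …, 2ⁿ − 1, hence are 1, 2, 4, … in some order; each flip of a coordinate
-- changes all but at most one of the corresponding digits. Finally FQ n (n even)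
-- and HFQ n (n odd) are isomorphic to H n, and each of their edges lies in an
-- embedded copy of Q n, so every magic labelling of them is an isomorphism to H n
-- and the embeddings of Q n correspond to its magic labellings.
module Submission where

open import Defs
open import Data.Bool.Base using (Bool; true; false; not; if_then_else_; _xor_)
open import Data.Bool.Properties
  using (not-involutive; xor-assoc; xor-same; xor-identityʳ; not-distribˡ-xor; not-distribʳ-xor)
  renaming (_≟_ to _≟ᵇ_)
open import Data.Fin.Base using (Fin; zero; suc; toℕ; fromℕ<; punchIn; punchOut; combine)
open import Data.Fin.Permutation using (Permutation; permutation)
open import Data.Fin.Properties
  using (any?; injective⇒≤; punchOut-injective; punchIn-injective; punchInᵢ≢i; toℕ-injective;
         toℕ-fromℕ<; toℕ<n; pigeonhole; combine-injective)
  renaming (suc-injective to sucᶠ-injective; _≟_ to _≟ᶠ_)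
open import Data.Nat.Base hiding (parity)
open import Data.Nat.Divisibility using (_∣_; _∤_; divides)
open import Data.Nat.Properties
open import Data.Nat.Tactic.RingSolver using (solve-∀)
open import Data.Product using (Σ-syntax; ∃-syntax; _×_; _,_; proj₁; proj₂)
open import Data.Sum.Base using (inj₁; inj₂)
open import Data.Vec.Base
  using (Vec; []; _∷_; lookup; map; replicate; insertAt; removeAt; zipWith; _[_]%=_)
open import Data.Vec.Properties
  using (removeAt-insertAt; insertAt-lookup; insertAt-removeAt; insertAt-punchIn; lookup-map;
         lookup∘updateAt; lookup∘updateAt′; map-id; tabulate∘lookup; tabulate-cong; ∷-injective)
open import Function.Base using (_∘_)
open import Function.Bundles using (Bijection; Inverse; _⤖_; mk⤖; mk⇔)
open import Function.Consequences.Propositional using (strictlySurjective⇒surjective)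
open import Function.Definitions using (Injective; StrictlySurjective)
open import Function.Properties.Bijection using (⤖⇒↔; sym-≡) renaming (trans to ⤖-trans)
open import Relation.Binary.PropositionalEquality
open import Relation.Nullary using (¬_; yes; no; contradiction)
open import Algebra.Properties.CommutativeMonoid.Sum +-0-commutativeMonoid
  using (sum; sum-permute; sum-cong-≗)
open import Algebra.Properties.CommutativeSemigroup +-commutativeSemigroup using (x∙yz≈y∙xz)

open Graph using (Vertex)

-- Finite sets and binary expansions

-- If a value `j` were missed, punching it out of the codomain would leave an injection from `suc n`
-- elements into `n`.
injective⇒surjective : ∀ {n} {f : Fin n → Fin n} →
  Injective _≡_ _≡_ f → StrictlySurjective _≡_ f
injective⇒surjective {zero} _ ()
injective⇒surjective {suc n} {f} inj j with any? (λ i → f i ≟ᶠ j)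
... | yes hit = hit
... | no ¬hit = contradiction
  (injective⇒≤ {f = λ i → punchOut (≢j i)}
    (λ eq → inj (punchOut-injective (≢j _) (≢j _) eq)))
  1+n≰n
  where
  ≢j : ∀ i → j ≢ f i
  ≢j i eq = ¬hit (i , sym eq)

odd : ℕ → Bool
odd zero    = false
odd (suc n) = not (odd n)

odd-2* : ∀ k → odd (2 * k) ≡ false
odd-2* zero = refl
odd-2* (suc k) = trans (cong odd (*-suc 2 k)) (trans (not-involutive _) (odd-2* k))

half-2* : ∀ k → ⌊ 2 * k /2⌋ ≡ k
half-2* zero = refl
half-2* (suc k) = trans (cong ⌊_/2⌋ (*-suc 2 k)) (cong suc (half-2* k))

half-1+2* : ∀ k → ⌊ 1 + 2 * k /2⌋ ≡ k
half-1+2* zero = refl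
half-1+2* (suc k) = trans (cong (⌊_/2⌋ ∘ suc) (*-suc 2 k)) (cong suc (half-1+2* k))

parity-split : ∀ k → k ≡ (if odd k then 1 else 0) + 2 * ⌊ k /2⌋
parity-split zero = refl
parity-split (suc zero) = refl
parity-split (suc (suc k)) = trans (cong (λ m → suc (suc m)) (parity-split k)) (lemma (odd k) ⌊ k /2⌋)
  where
  lemma : ∀ b m → 2 + ((if b then 1 else 0) + 2 * m) ≡ (if not (not b) then 1 else 0) + 2 * suc m
  lemma true  m = cong suc (sym (*-suc 2 m))
  lemma false m = sym (*-suc 2 m)

weigh : Bool → ℕ → ℕ
weigh b x = if b then x else 0

value : ∀ {n} → Vec Bool n → ℕ
value []      = 0
value (b ∷ w) = weigh b 1 + 2 * value w

digits : ∀ n → ℕ → Vec Bool n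
digits zero    k = []
digits (suc n) k = odd k ∷ digits n ⌊ k /2⌋

digits-value : ∀ {n} (w : Vec Bool n) → digits n (value w) ≡ w
digits-value [] = refl
digits-value {suc n} (true ∷ w) = cong₂ _∷_ (cong not (odd-2* (value w)))
  (trans (cong (digits n) (half-1+2* (value w))) (digits-value w))
digits-value {suc n} (false ∷ w) = cong₂ _∷_ (odd-2* (value w))
  (trans (cong (digits n) (half-2* (value w))) (digits-value w))

value-digits : ∀ n {k} → k < 2 ^ n → value (digits n k) ≡ k
value-digits zero    {zero} _ = refl
value-digits zero    {suc k} (s≤s ())
value-digits (suc n) {k} k<2^n = sym (trans (parity-split k)
  (cong (λ m → weigh (odd k) 1 + 2 * m) (sym (value-digits n
    (*-cancelˡ-< 2 _ _ (≤-<-trans (m≤n+m _ (weigh (odd k) 1))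
      (subst (_< 2 ^ suc n) (parity-split k) k<2^n)))))))

value<2^n : ∀ {n} (w : Vec Bool n) → value w < 2 ^ n
value<2^n [] = s≤s z≤n
value<2^n {suc n} (b ∷ w) = begin-strict
  weigh b 1 + 2 * value w  ≤⟨ +-monoˡ-≤ (2 * value w) (bit≤1 b) ⟩
  1 + 2 * value w          <⟨ n<1+n _ ⟩
  2 + 2 * value w          ≡⟨ *-suc 2 (value w) ⟨
  2 * suc (value w)        ≤⟨ *-monoʳ-≤ 2 (value<2^n w) ⟩
  2 * 2 ^ n                ∎
  where
  open ≤-Reasoning
  bit≤1 : ∀ b → weigh b 1 ≤ 1
  bit≤1 true  = s≤s z≤n
  bit≤1 false = z≤n

value-injective : ∀ {n} → Injective _≡_ _≡_ (value {n})
value-injective {n} {u} {v} eq =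
  trans (sym (digits-value u)) (trans (cong (digits n) eq) (digits-value v))

fin : ∀ {n} → Vec Bool n → Fin (2 ^ n)
fin w = fromℕ< (value<2^n w)

toℕ-fin : ∀ {n} (w : Vec Bool n) → toℕ (fin w) ≡ value w
toℕ-fin w = toℕ-fromℕ< (value<2^n w)

fin-digits : ∀ {n} (k : Fin (2 ^ n)) → fin (digits n (toℕ k)) ≡ k
fin-digits {n} k = toℕ-injective (trans (toℕ-fin (digits n (toℕ k))) (value-digits n (toℕ<n k)))

digits-toℕ-fin : ∀ {n} (w : Vec Bool n) → digits n (toℕ (fin w)) ≡ w
digits-toℕ-fin {n} w = trans (cong (digits n) (toℕ-fin w)) (digits-value w)

fin-injective : ∀ {n} → Injective _≡_ _≡_ (fin {n})
fin-injective {x = u} {v} eq = value-injective (trans (sym (toℕ-fin u)) (trans (cong toℕ eq) (toℕ-fin v)))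

-- Weights whose subset sums enumerate 0, …, 2ⁿ − 1

subsetSum : ∀ {n} → Vec ℕ n → Vec Bool n → ℕ
subsetSum []      []      = 0
subsetSum (x ∷ a) (b ∷ s) = weigh b x + subsetSum a s

subsetSum-∅ : ∀ {n} (a : Vec ℕ n) → subsetSum a (replicate n false) ≡ 0
subsetSum-∅ []      = refl
subsetSum-∅ (x ∷ a) = subsetSum-∅ a

subsetSum-complement : ∀ {n} (a : Vec ℕ n) s →
  subsetSum a (map not s) + subsetSum a s ≡ subsetSum a (replicate n true)
subsetSum-complement []      []      = refl
subsetSum-complement (x ∷ a) (b ∷ s) =
  trans (lemma b) (cong (x +_) (subsetSum-complement a s))
  where
  lemma : ∀ b → weigh (not b) x + subsetSum a (map not s) + (weigh b x + subsetSum a s)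
                ≡ x + (subsetSum a (map not s) + subsetSum a s)
  lemma true  = x∙yz≈y∙xz (subsetSum a (map not s)) x _
  lemma false = +-assoc x _ _

subsetSum-removeAt : ∀ {n} (a : Vec ℕ (suc n)) s k →
  subsetSum a s ≡ weigh (lookup s k) (lookup a k) + subsetSum (removeAt a k) (removeAt s k)
subsetSum-removeAt (x ∷ a)         (b ∷ s)         zero    = refl
subsetSum-removeAt (x ∷ a@(_ ∷ _)) (b ∷ s@(_ ∷ _)) (suc k) = trans
  (cong (weigh b x +_) (subsetSum-removeAt a s k))
  (x∙yz≈y∙xz (weigh b x) (weigh (lookup s k) (lookup a k)) _)

subsetSum-insertAt : ∀ {n} (a : Vec ℕ (suc n)) (t : Vec Bool n) k b →
  subsetSum a (insertAt t k b) ≡ weigh b (lookup a k) + subsetSum (removeAt a k) t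
subsetSum-insertAt a t k b = trans (subsetSum-removeAt a (insertAt t k b) k)
  (cong₂ (λ c r → weigh c (lookup a k) + subsetSum (removeAt a k) r)
    (insertAt-lookup t k b) (removeAt-insertAt t k b))

subsetSum-2* : ∀ {n} (a : Vec ℕ n) s → subsetSum (map (2 *_) a) s ≡ 2 * subsetSum a s
subsetSum-2* []      []      = refl
subsetSum-2* (x ∷ a) (b ∷ s) =
  trans (cong₂ _+_ (weigh-2* b) (subsetSum-2* a s)) (sym (*-distribˡ-+ 2 (weigh b x) _))
  where
  weigh-2* : ∀ b → weigh b (2 * x) ≡ 2 * weigh b x
  weigh-2* true  = refl
  weigh-2* false = refl

lookup-removeAt : ∀ {A : Set} {n} (v : Vec A (suc n)) k j →
  lookup (removeAt v k) j ≡ lookup v (punchIn k j)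
lookup-removeAt v k j = trans
  (sym (insertAt-punchIn (removeAt v k) k (lookup v k) j))
  (cong (λ w → lookup w (punchIn k j)) (insertAt-removeAt v k))

-- Among natural numbers with sum 1, one is 1 and all others are 0.
subsetSum≡1⇒weight1 : ∀ {n} (a : Vec ℕ n) s → subsetSum a s ≡ 1 → ∃[ k ] lookup a k ≡ 1
subsetSum≡1⇒weight1 []             []          ()
subsetSum≡1⇒weight1 (x ∷ a)        (false ∷ s) eq with subsetSum≡1⇒weight1 a s eq
... | k , a≡1 = suc k , a≡1
subsetSum≡1⇒weight1 (zero ∷ a)     (true ∷ s)  eq with subsetSum≡1⇒weight1 a s eq
... | k , a≡1 = suc k , a≡1
subsetSum≡1⇒weight1 (suc zero ∷ a) (true ∷ s)  eq = zero , refl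

-- Each weight is the subset sum of a singleton, hence even.
halve : ∀ {n} (a : Vec ℕ n) → (∀ s → odd (subsetSum a s) ≡ false) → ∃[ a′ ] a ≡ map (2 *_) a′
halve []      _    = [] , refl
halve {suc n} (x ∷ a) even with halve a (λ s → even (false ∷ s))
... | a′ , refl = ⌊ x /2⌋ ∷ a′ ,
  cong (_∷ map (2 *_) a′) (trans (parity-split x) (cong (λ b → weigh b 1 + 2 * ⌊ x /2⌋) even-x))
  where
  even-x : odd x ≡ false
  even-x = trans (cong odd (sym (trans (cong (x +_) (subsetSum-∅ (map (2 *_) a′))) (+-identityʳ x))))
    (even (true ∷ replicate n false))

-- Such weights turn out to be 1, 2, 4, ... in some order. The three conditions are kept together so
-- that they pass to shorter weight vectors by induction.
record Binary {n} (a : Vec ℕ n) : Set where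
  field
    bound     : ∀ s → subsetSum a s < 2 ^ n
    injective : Injective _≡_ _≡_ (subsetSum a)
    covers    : ∀ {m} → m < 2 ^ n → ∃[ s ] subsetSum a s ≡ m

-- One step of the induction: since 1 is a subset sum, some weight is 1; the other weights are even,
-- and their halves again form a binary system.
module LeastWeight {n} {a : Vec ℕ (suc n)} (binary : Binary a) where
  open Binary binary

  1<2^[1+n] : 1 < 2 ^ suc n
  1<2^[1+n] = *-monoʳ-≤ 2 (m^n>0 2 n)

  position : Fin (suc n)
  position = proj₁ (subsetSum≡1⇒weight1 a _ (proj₂ (covers 1<2^[1+n])))

  weight1 : lookup a position ≡ 1
  weight1 = proj₂ (subsetSum≡1⇒weight1 a _ (proj₂ (covers 1<2^[1+n])))

  rest : Vec ℕ n
  rest = removeAt a position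

  sum-split : ∀ s → subsetSum a s ≡ weigh (lookup s position) 1 + subsetSum rest (removeAt s position)
  sum-split s = trans (subsetSum-removeAt a s position)
    (cong (λ x → weigh (lookup s position) x + subsetSum rest (removeAt s position)) weight1)

  sum-insert : ∀ b t → subsetSum a (insertAt t position b) ≡ weigh b 1 + subsetSum rest t
  sum-insert b t = trans (subsetSum-insertAt a t position b)
    (cong (λ x → weigh b x + subsetSum rest t) weight1)

  -- Otherwise a set with and a set without the weight 1 would have equal sums.
  no-successor : ∀ t u → subsetSum rest u ≢ suc (subsetSum rest t)
  no-successor t u eq with trans (sym (insertAt-lookup t position true))
    (trans (cong (λ s → lookup s position)
      (injective (trans (sum-insert true t) (trans (sym eq) (sym (sum-insert false u))))))
      (insertAt-lookup u position false))
  ... | ()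

  -- By induction on `j`: a set with sum 2 + 2j containing the weight 1 would leave a sum 1 + 2j of
  -- the rest, right after the sum 2j, against `no-successor`.
  evens-covered : ∀ j → 2 * j < 2 ^ suc n → ∃[ t ] subsetSum rest t ≡ 2 * j
  evens-covered zero    _ = replicate n false , subsetSum-∅ rest
  evens-covered (suc j) 2+2j<2^n
    with 2+2j ← subst (_< 2 ^ suc n) (*-suc 2 j) 2+2j<2^n
    with t , t≡2j ← evens-covered j (≤-trans (n≤1+n _) (≤-trans (n≤1+n _) 2+2j))
    with s , s≡2+2j ← covers 2+2j
    with lookup s position | sum-split s
  ... | false | split = removeAt s position , trans (sym split) (trans s≡2+2j (sym (*-suc 2 j)))
  ... | true  | split = contradiction
    (trans (suc-injective (trans (sym split) s≡2+2j)) (cong suc (sym t≡2j)))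
    (no-successor t (removeAt s position))

  -- An odd sum 1 + 2j of the rest would be the successor of 2j, which the rest attains as well.
  rest-even : ∀ t → odd (subsetSum rest t) ≡ false
  rest-even t with odd (subsetSum rest t) | parity-split (subsetSum rest t)
  ... | false | _     = refl
  ... | true  | split with evens-covered ⌊ subsetSum rest t /2⌋
        (≤-trans (≤-reflexive (sym split))
          (≤-trans (≤-reflexive (sym (sum-insert false t))) (<⇒≤ (bound _))))
  ... | u , u≡2j = contradiction (trans split (cong suc (sym u≡2j))) (no-successor u t)

  halves : Vec ℕ n
  halves = proj₁ (halve rest rest-even)

  rest-sum : ∀ t → subsetSum rest t ≡ 2 * subsetSum halves t
  rest-sum t = trans (cong (λ r → subsetSum r t) (proj₂ (halve rest rest-even)))
    (subsetSum-2* halves t)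

  sum-insert-false : ∀ t → subsetSum a (insertAt t position false) ≡ 2 * subsetSum halves t
  sum-insert-false t = trans (sum-insert false t) (rest-sum t)

  halves-binary : Binary halves
  halves-binary = record
    { bound = λ t → *-cancelˡ-< 2 _ _ (subst (_< 2 ^ suc n) (sum-insert-false t) (bound _))
    ; injective = λ {t} {u} eq → trans (sym (removeAt-insertAt t position false))
        (trans (cong (λ s → removeAt s position)
          (injective (trans (sum-insert-false t) (trans (cong (2 *_) eq) (sym (sum-insert-false u))))))
          (removeAt-insertAt u position false))
    ; covers = λ {m} m<2^n → let t , eq = evens-covered m (*-monoʳ-< 2 m<2^n) in
        t , *-cancelˡ-≡ _ _ 2 (trans (sym (rest-sum t)) eq)
    }

  -- The weight 1 is the only odd one, so parity determines the least digit; cancelling it and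
  -- halving gives the remaining digits.
  least-digit : ∀ s b (w : Vec Bool n) → value (b ∷ w) ≡ subsetSum a s →
    b ≡ lookup s position × value w ≡ subsetSum halves (removeAt s position)
  least-digit s b w eq = head≡ , *-cancelˡ-≡ _ _ 2 (+-cancelˡ-≡ (weigh b 1) _ _
      (trans split (cong (λ c → weigh c 1 + 2 * subsetSum halves (removeAt s position)) (sym head≡))))
    where
    split : weigh b 1 + 2 * value w ≡ weigh (lookup s position) 1 + 2 * subsetSum halves (removeAt s position)
    split = trans eq (trans (sum-split s)
      (cong (weigh (lookup s position) 1 +_) (rest-sum (removeAt s position))))
    odd-bit : ∀ c k → odd (weigh c 1 + 2 * k) ≡ c
    odd-bit true  k = cong not (odd-2* k)
    odd-bit false k = odd-2* k
    head≡ : b ≡ lookup s position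
    head≡ = trans (sym (odd-bit b (value w))) (trans (cong odd split) 
      (odd-bit (lookup s position) (subsetSum halves (removeAt s position))))

-- Digit `k` of a subset sum tells whether the weight 2ᵏ is selected, and `π k` is the position of
-- that weight.
binary-digits-permute : ∀ {n} {a : Vec ℕ n} → Binary a →
  Σ[ π ∈ (Fin n → Fin n) ] (Injective _≡_ _≡_ π ×
    (∀ s w → value w ≡ subsetSum a s → ∀ k → lookup w k ≡ lookup s (π k)))
binary-digits-permute {zero}  _ = (λ ()) , (λ { {()} }) , (λ _ _ _ ())
binary-digits-permute {suc n} {a} binary with binary-digits-permute (LeastWeight.halves-binary binary)
... | π , π-inj , π-digits = π′ , (λ {i} {j} → π′-inj i j) , digit
  where
  open LeastWeight binary
  π′ : Fin (suc n) → Fin (suc n)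
  π′ zero    = position
  π′ (suc k) = punchIn position (π k)
  π′-inj : ∀ i j → π′ i ≡ π′ j → i ≡ j
  π′-inj zero    zero    _  = refl
  π′-inj zero    (suc j) eq = contradiction (sym eq) (punchInᵢ≢i position (π j))
  π′-inj (suc i) zero    eq = contradiction eq (punchInᵢ≢i position (π i))
  π′-inj (suc i) (suc j) eq = cong suc (π-inj (punchIn-injective position _ _ eq))
  digit : ∀ s w → value w ≡ subsetSum a s → ∀ k → lookup w k ≡ lookup s (π′ k)
  digit s (b ∷ w) eq zero    = proj₁ (least-digit s b w eq)
  digit s (b ∷ w) eq (suc k) = trans
    (π-digits (removeAt s position) w (proj₂ (least-digit s b w eq)) k)
    (lookup-removeAt s position (π k))

-- A choice of one set for each number below 2ⁿ is injective, hence surjective by counting; so every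
-- set is the one chosen for its own sum.
covering⇒binary : ∀ {n} {a : Vec ℕ n} → (∀ s → subsetSum a s < 2 ^ n) →
  (∀ {m} → m < 2 ^ n → ∃[ s ] subsetSum a s ≡ m) → Binary a
covering⇒binary {n} {a} bound covers = record
  { bound     = bound
  ; injective = λ {s} {t} eq →
      let i , i↦s = section-surjective s
          j , j↦t = section-surjective t
      in trans (sym i↦s) (trans (cong section (toℕ-injective
           (trans (sym (sum-section i)) (trans (cong (subsetSum a) i↦s)
             (trans eq (trans (cong (subsetSum a) (sym j↦t)) (sum-section j))))))) j↦t)
  ; covers    = covers
  }
  where
  section : Fin (2 ^ n) → Vec Bool n
  section k = proj₁ (covers (toℕ<n k))

  sum-section : ∀ k → subsetSum a (section k) ≡ toℕ k
  sum-section k = proj₂ (covers (toℕ<n k))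

  section-surjective : StrictlySurjective _≡_ section
  section-surjective s =
    let k , eq = injective⇒surjective {f = fin ∘ section}
          (λ {i} {j} e → toℕ-injective (trans (sym (sum-section i))
            (trans (cong (subsetSum a) (fin-injective e)) (sum-section j)))) (fin s)
    in k , fin-injective eq

-- Labellings of the cube with constant face sums

flip : ∀ {n} → Fin n → Vec Bool n → Vec Bool n
flip i v = v [ i ]%= not

parity : ∀ {n} → Vec Bool n → Bool
parity []      = false
parity (b ∷ v) = b xor parity v

parity-flip : ∀ {n} i (v : Vec Bool n) → parity (flip i v) ≡ not (parity v)
parity-flip zero    (b ∷ v) = sym (not-distribˡ-xor b (parity v))
parity-flip (suc i) (b ∷ v) = trans (cong (b xor_) (parity-flip i v)) (sym (not-distribʳ-xor b (parity v)))

zeros : ∀ {n} → Vec Bool n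
zeros = replicate _ false

-- Every vertex is reached from `zeros` by flips.
cube-induction : ∀ {n} {P : Vec Bool n → Set} → P zeros →
  (∀ i v → P v → P (flip i v)) → ∀ v → P v
cube-induction {zero}  base step [] = base
cube-induction {suc n} {P} base step (b ∷ v) = head b
  where
  tail : P (false ∷ v)
  tail = cube-induction {P = P ∘ (false ∷_)} base (λ i w → step (suc i) (false ∷ w)) v
  head : ∀ b → P (b ∷ v)
  head false = tail
  head true  = step zero (false ∷ v) tail

-- The first coordinate is summed out first: one unfolding pairs the values `2 * k` and `1 + 2 * k`,
-- and two unfoldings give the faces of `face-constant`.
sumAll : ∀ n → (Vec Bool n → ℕ) → ℕ
sumAll zero    f = f []
sumAll (suc n) f = sumAll n (λ w → f (false ∷ w) + f (true ∷ w))

sumAll-cong : ∀ n {f g : Vec Bool n → ℕ} → (∀ v → f v ≡ g v) → sumAll n f ≡ sumAll n g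
sumAll-cong zero    eq = eq []
sumAll-cong (suc n) eq = sumAll-cong n (λ w → cong₂ _+_ (eq (false ∷ w)) (eq (true ∷ w)))

sumAll-const : ∀ n c → sumAll n (λ _ → c) ≡ 2 ^ n * c
sumAll-const zero    c = sym (+-identityʳ c)
sumAll-const (suc n) c = trans (sumAll-const n (c + c)) (lemma (2 ^ n) c)
  where
  lemma : ∀ p c → p * (c + c) ≡ 2 * p * c
  lemma = solve-∀

sum-pairs : ∀ n (F : ℕ → ℕ) →
  sum {n * 2} (F ∘ toℕ) ≡ sum {n} ((λ k → F (2 * k) + F (1 + 2 * k)) ∘ toℕ)
sum-pairs zero    F = refl
sum-pairs (suc n) F = trans (sym (+-assoc (F 0) (F 1) _))
  (cong (F 0 + F 1 +_) (trans (sum-pairs n (λ k → F (2 + k)))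
    (sum-cong-≗ {n} (λ k → cong (λ m → F m + F (1 + m)) (sym (*-suc 2 (toℕ k)))))))

sum-value : ∀ n (F : ℕ → ℕ) → sum {2 ^ n} (F ∘ toℕ) ≡ sumAll n (F ∘ value)
sum-value zero    F = +-identityʳ (F 0)
sum-value (suc n) F = trans (cong (λ m → sum {m} (F ∘ toℕ)) (*-comm 2 (2 ^ n)))
  (trans (sum-pairs (2 ^ n) F) (sum-value n (λ k → F (2 * k) + F (1 + 2 * k))))

-- The formula 0 + 1 + ... + (n - 1) = n(n - 1)/2, arranged without division or subtraction.
sum-toℕ : ∀ n → 2 * sum {n} toℕ + n ≡ n * n
sum-toℕ zero    = refl
sum-toℕ (suc n) = trans (cong (λ s → 2 * s + suc n) (sum-suc n toℕ))
  (trans (lemma (sum {n} toℕ) n) (trans (cong (λ s → suc (s + (n + n))) (sum-toℕ n)) (square n)))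
  where
  sum-suc : ∀ n (f : Fin n → ℕ) → sum (suc ∘ f) ≡ n + sum f
  sum-suc zero    f = refl
  sum-suc (suc n) f = trans (cong (λ s → suc (f zero + s)) (sum-suc n (f ∘ suc)))
    (cong suc (x∙yz≈y∙xz (f zero) n _))
  lemma : ∀ s n → 2 * (n + s) + suc n ≡ suc (2 * s + n + (n + n))
  lemma = solve-∀
  square : ∀ n → suc (n * n + (n + n)) ≡ suc n * suc n
  square = solve-∀

-- Indexing the vertices by their binary values turns `f` into a permutation of the numbers below
-- 2ⁿ, which does not affect the sum.
sumAll-bijection : ∀ {n} (f : Vec Bool n ⤖ Fin (2 ^ n)) →
  sumAll n (toℕ ∘ Bijection.to f) ≡ sum {2 ^ n} toℕ
sumAll-bijection {n} f = begin
  sumAll n (toℕ ∘ to)                       ≡⟨ sumAll-cong n (λ v → cong (toℕ ∘ to) (sym (digits-value v))) ⟩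
  sumAll n (toℕ ∘ to ∘ digits n ∘ value)    ≡⟨ sum-value n (toℕ ∘ to ∘ digits n) ⟨
  sum {2 ^ n} (toℕ ∘ to ∘ digits n ∘ toℕ)   ≡⟨ sum-permute toℕ π ⟨
  sum {2 ^ n} toℕ                           ∎
  where
  open Inverse (⤖⇒↔ f) using (to; from; strictlyInverseˡ; strictlyInverseʳ)
  open ≡-Reasoning
  π : Permutation (2 ^ n) (2 ^ n)
  π = permutation (to ∘ digits n ∘ toℕ) (fin ∘ from)
    (λ k → trans (cong to (digits-toℕ-fin (from k))) (strictlyInverseˡ k))
    (λ k → trans (cong fin (strictlyInverseʳ (digits n (toℕ k)))) (fin-digits {n} k))

-- Averaging: the faces in the first two directions partition the cube.
face-constant : ∀ m S (f : Vec Bool (2 + m) ⤖ Fin (2 ^ (2 + m))) →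
  (∀ v → let g = λ b c → toℕ (Bijection.to f (b ∷ c ∷ v)) in
     g false false + g true false + (g false true + g true true) ≡ S) →
  S + 2 ≡ 2 * 2 ^ (2 + m)
face-constant m S f face = *-cancelˡ-≡ _ _ (2 * 2 ^ m) {{m*n≢0 2 (2 ^ m) {{_}} {{m^n≢0 2 m}}}} (begin
  2 * 2 ^ m * (S + 2)                    ≡⟨ lemma (2 ^ m) S ⟩
  2 * (2 ^ m * S) + 2 ^ (2 + m)          ≡⟨ cong (λ s → 2 * s + 2 ^ (2 + m)) (trans total (sumAll-bijection f)) ⟩
  2 * sum {2 ^ (2 + m)} toℕ + 2 ^ (2 + m) ≡⟨ sum-toℕ (2 ^ (2 + m)) ⟩
  2 ^ (2 + m) * 2 ^ (2 + m)              ≡⟨ square (2 ^ m) ⟩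
  2 * 2 ^ m * (2 * 2 ^ (2 + m))          ∎)
  where
  open ≡-Reasoning
  lemma : ∀ p S → 2 * p * (S + 2) ≡ 2 * (p * S) + 2 * (2 * p)
  lemma = solve-∀
  square : ∀ p → 2 * (2 * p) * (2 * (2 * p)) ≡ 2 * p * (2 * (2 * (2 * p)))
  square = solve-∀
  total : 2 ^ m * S ≡ sumAll (2 + m) (toℕ ∘ Bijection.to f)
  total = trans (sym (sumAll-const m S)) (sumAll-cong m (sym ∘ face))

-- Additive functions on the cube are subset sums

Additive : ∀ {n} → (Vec Bool n → ℕ) → Set
Additive h = ∀ v {i j} → i ≢ j → h v + h (flip j (flip i v)) ≡ h (flip i v) + h (flip j v)

-- Mixed second differences of `h` vanish, so the increment in each direction is the same at all
-- vertices. The weight of a coordinate is thus the value at its unit vector.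
additive⇒subsetSum : ∀ {n} (h : Vec Bool n → ℕ) → h zeros ≡ 0 → Additive h →
  ∃[ a ] (∀ v → h v ≡ subsetSum a v)
additive⇒subsetSum {zero}  h h0 add = [] , λ { [] → h0 }
additive⇒subsetSum {suc n} h h0 add
  with a , h≡ ← additive⇒subsetSum (h ∘ (false ∷_)) h0
         (λ v i≢j → add (false ∷ v) (i≢j ∘ sucᶠ-injective))
  = h (true ∷ zeros) ∷ a , λ { (b ∷ v) → split b v }
  where
  split-true : ∀ v → h (true ∷ v) ≡ h (true ∷ zeros) + h (false ∷ v)
  split-true = cube-induction (sym (trans (cong (h (true ∷ zeros) +_) h0) (+-identityʳ _))) step
    where
    cancel : ∀ {p q r s t} → p + q ≡ r + s → r ≡ t + p → q ≡ t + s
    cancel {p} {q} {_} {s} {t} eq refl = +-cancelˡ-≡ p q (t + s) (trans eq (lemma t p s))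
      where
      lemma : ∀ t p s → t + p + s ≡ p + (t + s)
      lemma = solve-∀
    step : ∀ i v → h (true ∷ v) ≡ h (true ∷ zeros) + h (false ∷ v) →
      h (true ∷ flip i v) ≡ h (true ∷ zeros) + h (false ∷ flip i v)
    step i v eq = cancel (add (false ∷ v) {zero} {suc i} (λ ())) eq
  split : ∀ b v → h (b ∷ v) ≡ subsetSum (h (true ∷ zeros) ∷ a) (b ∷ v)
  split true  v = trans (split-true v) (cong (h (true ∷ zeros) +_) (h≡ v))
  split false v = h≡ v

lookup-ext : ∀ {A : Set} {n} {u v : Vec A n} → (∀ i → lookup u i ≡ lookup v i) → u ≡ v
lookup-ext {u = u} {v} eq = trans (sym (tabulate∘lookup u)) (trans (tabulate-cong eq) (tabulate∘lookup v))

lookup-flip : ∀ {n} (i : Fin n) v → lookup (flip i v) i ≡ not (lookup v i)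
lookup-flip i v = lookup∘updateAt i v

lookup-flip-≢ : ∀ {n} {i j : Fin n} → j ≢ i → ∀ v → lookup (flip i v) j ≡ lookup v j
lookup-flip-≢ {i = i} {j} j≢i v = lookup∘updateAt′ j i j≢i v

-- Agreement of words, and the weights selected at a vertex

AgreeAtMostOnce : ∀ {n} → Vec Bool n → Vec Bool n → Set
AgreeAtMostOnce u v = ∀ {i j} → lookup u i ≡ lookup v i → lookup u j ≡ lookup v j → i ≡ j

≢not : ∀ b → b ≢ not b
≢not true  ()
≢not false ()

≡not : ∀ {b c} → b ≢ c → c ≡ not b
≡not {true}  {true}  b≢c = contradiction refl b≢c
≡not {true}  {false} b≢c = refl
≡not {false} {true}  b≢c = refl
≡not {false} {false} b≢c = contradiction refl b≢c

parity-true⇒lookup : ∀ {n} (v : Vec Bool n) → parity v ≡ true → ∃[ i ] lookup v i ≡ true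
parity-true⇒lookup (true ∷ v)  _  = zero , refl
parity-true⇒lookup (false ∷ v) eq with i , vᵢ ← parity-true⇒lookup v eq = suc i , vᵢ

parity-zeros : ∀ n → parity (zeros {n}) ≡ false
parity-zeros zero    = refl
parity-zeros (suc n) = parity-zeros n

subsetSum≤total : ∀ {n} (a : Vec ℕ n) s → subsetSum a s ≤ subsetSum a (replicate n true)
subsetSum≤total a s = subst (subsetSum a s ≤_) (subsetSum-complement a s) (m≤n+m _ _)

subsetSum≡0⇒weight0 : ∀ {n} (a : Vec ℕ n) s k → subsetSum a s ≡ 0 → lookup s k ≡ true → lookup a k ≡ 0
subsetSum≡0⇒weight0 (x ∷ a) (true ∷ s) zero    eq _  = m+n≡0⇒m≡0 x eq
subsetSum≡0⇒weight0 (x ∷ a) (b ∷ s)    (suc k) eq sₖ =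
  subsetSum≡0⇒weight0 a s k (m+n≡0⇒n≡0 (weigh b x) eq) sₖ

-- The weights selected at `v` in `Centred`: at an odd vertex the reflection at `M` complements the
-- set of slopes, and the leading entry adds the weight that completes the total to `M`.
bits : ∀ {n} → Vec Bool n → Vec Bool (suc n)
bits v = parity v ∷ map (parity v xor_) v

-- Flipping coordinate `i` changes the parity and so complements every entry, except that entry
-- `suc i` is complemented twice.
bits-flip-agree : ∀ {n} i (v : Vec Bool n) j → lookup (bits v) j ≡ lookup (bits (flip i v)) j → j ≡ suc i
bits-flip-agree i v zero    eq = contradiction (trans eq (parity-flip i v)) (≢not (parity v))
bits-flip-agree i v (suc j) eq with j ≟ᶠ i
... | yes refl = refl
... | no j≢i   = contradiction
  (begin
    p xor lookup v j                     ≡⟨ lookup-map j (p xor_) v ⟨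
    lookup (map (p xor_) v) j            ≡⟨ eq ⟩
    lookup (map (q xor_) (flip i v)) j   ≡⟨ lookup-map j (q xor_) (flip i v) ⟩
    q xor lookup (flip i v) j            ≡⟨ cong₂ _xor_ (parity-flip i v) (lookup-flip-≢ j≢i v) ⟩
    not p xor lookup v j                 ≡⟨ not-distribˡ-xor p (lookup v j) ⟨
    not (p xor lookup v j)               ∎)
  (≢not _)
  where
  open ≡-Reasoning
  p = parity v
  q = parity (flip i v)

-- The case in which the value 0 sits at `zeros`; here `M` is the largest value and faces have sum
-- `M + M`. The general case follows by translation in `faces⇒flip-agree`.
module Centred {n M} (2^n≡1+M : 2 ^ n ≡ suc M) (f : Vec Bool n → ℕ)
  (f<2^n : ∀ v → f v < 2 ^ n) (f-covers : ∀ {m} → m < 2 ^ n → ∃[ v ] f v ≡ m) (f-zeros : f zeros ≡ 0)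
  (face : ∀ v {i j} → i ≢ j → f v + f (flip i v) + f (flip j (flip i v)) + f (flip j v) ≡ M + M)
  where

  f≤M : ∀ v → f v ≤ M
  f≤M v = s≤s⁻¹ (subst (f v <_) 2^n≡1+M (f<2^n v))

  reflect : Bool → ℕ → ℕ
  reflect b x = if b then M ∸ x else x

  -- Taking the complement M − f at odd vertices turns constant face sums into
  -- additivity.
  height : Vec Bool n → ℕ
  height v = reflect (parity v) (f v)

  f≡reflect-height : ∀ v → f v ≡ reflect (parity v) (height v)
  f≡reflect-height v with parity v
  ... | true  = sym (m∸[m∸n]≡n (f≤M v))
  ... | false = refl

  height≤M : ∀ v → height v ≤ M
  height≤M v with parity v
  ... | true  = m∸n≤m M (f v)
  ... | false = f≤M v

  height-zeros : height zeros ≡ 0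
  height-zeros = trans (cong (λ b → reflect b (f zeros)) (parity-zeros n)) f-zeros

  complement-sum : ∀ x z {y w} → y ≤ M → w ≤ M → x + y + z + w ≡ M + M → x + z ≡ (M ∸ y) + (M ∸ w)
  complement-sum x z {y} {w} y≤M w≤M eq = +-cancelʳ-≡ (y + w) _ _
    (begin
      x + z + (y + w)               ≡⟨ lemma₁ x z y w ⟩
      x + y + z + w                 ≡⟨ eq ⟩
      M + M                         ≡⟨ cong₂ _+_ (m∸n+n≡m y≤M) (m∸n+n≡m w≤M) ⟨
      M ∸ y + y + (M ∸ w + w)       ≡⟨ lemma₂ (M ∸ y) y (M ∸ w) w ⟩
      (M ∸ y) + (M ∸ w) + (y + w)   ∎)
    where
    open ≡-Reasoning
    lemma₁ : ∀ x z y w → x + z + (y + w) ≡ x + y + z + w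
    lemma₁ = solve-∀
    lemma₂ : ∀ a y b w → a + y + (b + w) ≡ a + b + (y + w)
    lemma₂ = solve-∀

  -- Exactly one diagonal of each face consists of odd vertices; reflecting it turns the face sum
  -- `M + M` into equality of the two diagonal sums.
  height-additive : Additive height
  height-additive v {i} {j} i≢j
    rewrite parity-flip j (flip i v) | parity-flip i v | parity-flip j v
    with parity v
  ... | false = complement-sum (f v) _ (f≤M _) (f≤M _) (face v i≢j)
  ... | true  = sym (complement-sum (f (flip i v)) (f (flip j v)) (f≤M v) (f≤M _)
                  (trans (lemma (f (flip i v)) (f v) (f (flip j v)) _) (face v i≢j)))
    where
    lemma : ∀ y x w z → y + x + w + z ≡ x + y + z + w
    lemma = solve-∀

  slopes : Vec ℕ n
  slopes = proj₁ (additive⇒subsetSum height height-zeros height-additive)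

  height≡ : ∀ v → height v ≡ subsetSum slopes v
  height≡ = proj₂ (additive⇒subsetSum height height-zeros height-additive)

  total : ℕ
  total = subsetSum slopes (replicate n true)

  total≤M : total ≤ M
  total≤M = subst (_≤ M) (height≡ (replicate n true)) (height≤M _)

  -- The extra weight makes the total equal to `M`, so that reflecting a sum at `M` amounts to
  -- passing to the complementary set.
  weights : Vec ℕ (suc n)
  weights = M ∸ total ∷ slopes

  total-weight : subsetSum weights (replicate (suc n) true) ≡ M
  total-weight = m∸n+n≡m total≤M

  f≡subsetSum : ∀ v → f v ≡ subsetSum weights (bits v)
  f≡subsetSum v = trans (f≡reflect-height v)
    (trans (cong (reflect (parity v)) (height≡ v)) (go (parity v)))
    where
    open ≡-Reasoning
    go : ∀ p → reflect p (subsetSum slopes v) ≡ subsetSum weights (p ∷ map (p xor_) v)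
    go false = cong (subsetSum slopes) (sym (map-id v))
    go true  = begin
      M ∸ σ              ≡⟨ cong (_∸ σ) total-weight ⟨
      a₀ + total ∸ σ     ≡⟨ cong (λ t → a₀ + t ∸ σ) (subsetSum-complement slopes v) ⟨
      a₀ + (c + σ) ∸ σ   ≡⟨ cong (_∸ σ) (+-assoc a₀ c σ) ⟨
      a₀ + c + σ ∸ σ     ≡⟨ m+n∸n≡m (a₀ + c) σ ⟩
      a₀ + c             ∎
      where
      a₀ = M ∸ total
      σ = subsetSum slopes v
      c = subsetSum slopes (map not v)

  -- The bits at the vertex of maximal value M are constant on the support of
  -- the weights, but bits v is never constantly true.
  null-weight : ∃[ z ] lookup weights z ≡ 0
  null-weight with v , fv≡M ← f-covers (subst (M <_) (sym 2^n≡1+M) (n<1+n M)) = z , null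
    where
    false-bit : ∀ (v : Vec Bool n) → ∃[ z ] lookup (bits v) z ≡ false
    false-bit v with parity v in eq
    ... | false = zero , refl
    ... | true  with i , vᵢ ← parity-true⇒lookup v eq = suc i ,
      trans (lookup-map i not v) (cong not vᵢ)
    z = proj₁ (false-bit v)
    complement≡0 : subsetSum weights (map not (bits v)) ≡ 0
    complement≡0 = +-cancelʳ-≡ M _ 0
      (trans (cong (subsetSum weights (map not (bits v)) +_) (trans (sym fv≡M) (f≡subsetSum v)))
        (trans (subsetSum-complement weights (bits v)) total-weight))
    null : lookup weights z ≡ 0
    null = subsetSum≡0⇒weight0 weights (map not (bits v)) z complement≡0
      (trans (lookup-map z not (bits v)) (cong not (proj₂ (false-bit v))))

  z : Fin (suc n)
  z = proj₁ null-weight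

  rest : Vec ℕ n
  rest = removeAt weights z

  f≡subsetSum-rest : ∀ v → f v ≡ subsetSum rest (removeAt (bits v) z)
  f≡subsetSum-rest v = trans (f≡subsetSum v) (trans (subsetSum-removeAt weights (bits v) z)
    (cong (_+ subsetSum rest (removeAt (bits v) z))
      (trans (cong (weigh b) (proj₂ null-weight)) (weigh-0 b))))
    where
    b = lookup (bits v) z
    weigh-0 : ∀ b → weigh b 0 ≡ 0
    weigh-0 true  = refl
    weigh-0 false = refl

  -- Dropping a null weight loses no sums, so the remaining `n` weights still attain every value of
  -- `f`, that is, every number below 2ⁿ.
  rest-binary : Binary rest
  rest-binary = covering⇒binary
    (λ s → subst (subsetSum rest s <_) (sym 2^n≡1+M) (s≤s (subst₂ _≤_
      (subsetSum-insertAt weights s z false) total-weight (subsetSum≤total weights (insertAt s z false)))))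
    (λ m<2^n → let v , fv≡m = f-covers m<2^n in
      removeAt (bits v) z , trans (sym (f≡subsetSum-rest v)) fv≡m)

  -- The digits of `f v` are, up to order, the entries of `bits v` other than entry `z`, and a flip
  -- keeps only entry `suc i`. Injectivity of the reordering then leaves at most one common digit.
  flip-agree : ∀ i v → AgreeAtMostOnce (digits n (f v)) (digits n (f (flip i v)))
  flip-agree i v {k} {l} eqₖ eqₗ
    with π , π-injective , π-digits ← binary-digits-permute rest-binary =
    π-injective (punchIn-injective z _ _ (trans (locate k eqₖ) (sym (locate l eqₗ))))
    where
    lookup-digits : ∀ v k → lookup (digits n (f v)) k ≡ lookup (bits v) (punchIn z (π k))
    lookup-digits v k = trans
      (π-digits (removeAt (bits v) z) (digits n (f v)) (trans (value-digits n (f<2^n v)) (f≡subsetSum-rest v)) k)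
      (lookup-removeAt (bits v) z (π k))
    locate : ∀ k → lookup (digits n (f v)) k ≡ lookup (digits n (f (flip i v))) k → punchIn z (π k) ≡ suc i
    locate k eq = bits-flip-agree i v (punchIn z (π k))
      (trans (sym (lookup-digits v k)) (trans eq (lookup-digits (flip i v) k)))

-- Translations of the cube

xor-cancelʳ : ∀ b c → (b xor c) xor c ≡ b
xor-cancelʳ b c = trans (xor-assoc b c c) (trans (cong (b xor_) (xor-same c)) (xor-identityʳ b))

_⊕_ : ∀ {n} → Vec Bool n → Vec Bool n → Vec Bool n
_⊕_ = zipWith _xor_

⊕-zeros : ∀ {n} (v : Vec Bool n) → zeros ⊕ v ≡ v
⊕-zeros []      = refl
⊕-zeros (b ∷ v) = cong (b ∷_) (⊕-zeros v)

⊕-cancel : ∀ {n} (v t : Vec Bool n) → (v ⊕ t) ⊕ t ≡ v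
⊕-cancel []      []      = refl
⊕-cancel (b ∷ v) (c ∷ t) = cong₂ _∷_ (xor-cancelʳ b c) (⊕-cancel v t)

flip-⊕ : ∀ {n} i (v t : Vec Bool n) → flip i v ⊕ t ≡ flip i (v ⊕ t)
flip-⊕ zero    (b ∷ v) (c ∷ t) = cong (_∷ v ⊕ t) (sym (not-distribˡ-xor b c))
flip-⊕ (suc i) (b ∷ v) (c ∷ t) = cong ((b xor c) ∷_) (flip-⊕ i v t)

-- Translation by the vertex `t` of value 0 brings that value to `zeros` and commutes with flips.
faces⇒flip-agree : ∀ {n M} → 2 ^ n ≡ suc M → (f : Vec Bool n → ℕ) →
  (∀ v → f v < 2 ^ n) → (∀ {m} → m < 2 ^ n → ∃[ v ] f v ≡ m) →
  (∀ v {i j} → i ≢ j → f v + f (flip i v) + f (flip j (flip i v)) + f (flip j v) ≡ M + M) →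
  ∀ i v → AgreeAtMostOnce (digits n (f v)) (digits n (f (flip i v)))
faces⇒flip-agree {n} {M} 2^n≡1+M f f<2^n covers face i v
  with t , ft≡0 ← covers (m^n>0 2 n) =
  subst₂ (λ x y → AgreeAtMostOnce (digits n (f x)) (digits n (f y)))
    (⊕-cancel v t) (trans (flip-⊕ i (v ⊕ t) t) (cong (flip i) (⊕-cancel v t)))
    (Centred.flip-agree 2^n≡1+M (λ w → f (w ⊕ t)) (λ w → f<2^n (w ⊕ t))
      (λ m<2^n → let w , fw≡m = covers m<2^n in w ⊕ t , trans (cong f (⊕-cancel w t)) fw≡m)
      (trans (cong f (⊕-zeros t)) ft≡0)
      (λ w {i} {j} i≢j → trans
        (cong₂ _+_ (cong₂ (λ x y → f (w ⊕ t) + f x + f y) (flip-⊕ i w t)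
          (trans (flip-⊕ j (flip i w) t) (cong (flip j) (flip-⊕ i w t)))) (cong f (flip-⊕ j w t)))
        (face (w ⊕ t) i≢j))
      i (v ⊕ t))

-- The graph of codes

one⇒flip : ∀ {n} {u v : Vec Bool n} → DifferInExactlyOne u v → ∃[ i ] v ≡ flip i u
one⇒flip {u = u} {v} (i , differ , unique) = i , lookup-ext at
  where
  at : ∀ j → lookup v j ≡ lookup (flip i u) j
  at j with j ≟ᶠ i
  ... | yes refl = trans (≡not differ) (sym (lookup-flip i u))
  ... | no j≢i with lookup u j ≟ᵇ lookup v j
  ...   | yes eq    = trans (sym eq) (sym (lookup-flip-≢ j≢i u))
  ...   | no differ′ = contradiction (sym (unique differ′)) j≢i

flip⇒one : ∀ {n} i (u : Vec Bool n) → DifferInExactlyOne u (flip i u)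
flip⇒one i u = i , (λ eq → ≢not (lookup u i) (trans eq (lookup-flip i u))) , unique
  where
  unique : ∀ {j} → lookup u j ≢ lookup (flip i u) j → i ≡ j
  unique {j} differ with j ≟ᶠ i
  ... | yes refl = refl
  ... | no j≢i   = contradiction (sym (lookup-flip-≢ j≢i u)) differ

-- The Cayley graph of binary words under `_⊕_` generated by the nonzero words with at most one
-- digit 0. For `n ≤ 1` every word agrees with itself at most once, so distinctness has to be
-- demanded.
H : ℕ → Graph
H n = record
  { Vertex   = Vec Bool n
  ; _~_      = λ u v → u ≢ v × AgreeAtMostOnce u v
  ; ~-sym    = λ (u≢v , agree) → ≢-sym u≢v , λ eq eq′ → agree (sym eq) (sym eq′)
  ; ~-irrefl = λ u≡v (u≢v , _) → u≢v u≡v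
  }

same-twice : ∀ {a b c} → b ≢ a → c ≢ b → a ≡ c
same-twice {a} {b} {c} b≢a c≢b = trans (≡not b≢a) (sym (≡not (≢-sym c≢b)))

-- Place `k` is the only one kept in either step, so every other place changes twice and returns to
-- its value.
two-steps : ∀ {n} (a b c : Vec Bool n) {k} → AgreeAtMostOnce a b → AgreeAtMostOnce b c →
  lookup a k ≡ lookup b k → lookup b k ≡ lookup c k → a ≡ c
two-steps a b c {k} ab bc eq eq′ = lookup-ext at
  where
  at : ∀ j → lookup a j ≡ lookup c j
  at j with j ≟ᶠ k
  ... | yes refl = trans eq eq′
  ... | no j≢k   = same-twice (λ e → j≢k (ab (sym e) eq)) (λ e → j≢k (bc (sym e) eq′))

-- Place `k` contributes 2 · 2ᵏ, in total 2 · (2ⁿ - 1); the summand 2 on the left replaces the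
-- subtraction.
value-4-sum : ∀ {n} (a b c d : Vec Bool n) →
  (∀ k → weigh (lookup a k) 1 + weigh (lookup b k) 1 + weigh (lookup c k) 1 + weigh (lookup d k) 1 ≡ 2) →
  value a + value b + value c + value d + 2 ≡ 2 * 2 ^ n
value-4-sum []      []      []      []      _        = refl
value-4-sum {suc n} (a ∷ as) (b ∷ bs) (c ∷ cs) (d ∷ ds) balanced = trans
  (rearrange (weigh a 1) (weigh b 1) (weigh c 1) (weigh d 1) (value as) (value bs) (value cs) (value ds))
  (trans (cong (λ s → s + 2 * (value as + value bs + value cs + value ds) + 2) (balanced zero))
    (trans (lemma (value as + value bs + value cs + value ds))
      (cong (2 *_) (value-4-sum as bs cs ds (balanced ∘ suc)))))
  where
  rearrange : ∀ a b c d as bs cs ds →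
    a + 2 * as + (b + 2 * bs) + (c + 2 * cs) + (d + 2 * ds) + 2 ≡ a + b + c + d + 2 * (as + bs + cs + ds) + 2
  rearrange = solve-∀
  lemma : ∀ s → 2 + 2 * s + 2 ≡ 2 * (s + 2)
  lemma = solve-∀

fin⤖ : ∀ n → Vec Bool n ⤖ Fin (2 ^ n)
fin⤖ n = mk⤖ (fin-injective , strictlySurjective⇒surjective (λ k → digits n (toℕ k) , fin-digits {n} k))

4-suc : ∀ a b c d → suc a + suc b + suc c + suc d ≡ a + b + c + d + 4
4-suc = solve-∀

binaryMagic : ∀ n → MagicLabelling (H n) n
binaryMagic n = record { labelling = fin⤖ n ; magic = λ C C′ → trans (constant C) (sym (constant C′)) }
  where
  -- Without three cyclically consecutive equal bits, only the six patterns with two ones remain.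
  bits-balanced : ∀ a b c d → ¬ (a ≡ b × b ≡ c) → ¬ (b ≡ c × c ≡ d) → ¬ (c ≡ d × d ≡ a) → ¬ (d ≡ a × a ≡ b) →
    weigh a 1 + weigh b 1 + weigh c 1 + weigh d 1 ≡ 2
  bits-balanced true  true  true  d     n₁ n₂ n₃ n₄ = contradiction (refl , refl) n₁
  bits-balanced false false false d     n₁ n₂ n₃ n₄ = contradiction (refl , refl) n₁
  bits-balanced false true  true  true  n₁ n₂ n₃ n₄ = contradiction (refl , refl) n₂
  bits-balanced true  false false false n₁ n₂ n₃ n₄ = contradiction (refl , refl) n₂
  bits-balanced true  false true  true  n₁ n₂ n₃ n₄ = contradiction (refl , refl) n₃
  bits-balanced false true  false false n₁ n₂ n₃ n₄ = contradiction (refl , refl) n₃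
  bits-balanced true  true  false true  n₁ n₂ n₃ n₄ = contradiction (refl , refl) n₄
  bits-balanced false false true  false n₁ n₂ n₃ n₄ = contradiction (refl , refl) n₄
  bits-balanced true  true  false false _ _ _ _ = refl
  bits-balanced true  false true  false _ _ _ _ = refl
  bits-balanced true  false false true  _ _ _ _ = refl
  bits-balanced false true  true  false _ _ _ _ = refl
  bits-balanced false true  false true  _ _ _ _ = refl
  bits-balanced false false true  true  _ _ _ _ = refl

  constant : (C : FourCycle (H n)) →
    sumAround {H n} (λ v → suc (toℕ (fin v))) C ≡ 2 * 2 ^ n + 2
  constant C = begin
    suc (toℕ (fin a)) + suc (toℕ (fin b)) + suc (toℕ (fin c)) + suc (toℕ (fin d))
      ≡⟨ cong₂ _+_ (cong₂ _+_ (cong₂ _+_ (label≡ a) (label≡ b)) (label≡ c)) (label≡ d) ⟩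
    suc (value a) + suc (value b) + suc (value c) + suc (value d)
      ≡⟨ lemma (value a) (value b) (value c) (value d) ⟩
    value a + value b + value c + value d + 2 + 2
      ≡⟨ cong (_+ 2) (value-4-sum a b c d λ k → bits-balanced (lookup a k) (lookup b k) (lookup c k) (lookup d k)
           (λ (e , e′) → a≢c (two-steps a b c (proj₂ a~b) (proj₂ b~c) e e′))
           (λ (e , e′) → b≢d (two-steps b c d (proj₂ b~c) (proj₂ c~d) e e′))
           (λ (e , e′) → a≢c (sym (two-steps c d a (proj₂ c~d) (proj₂ d~a) e e′)))
           (λ (e , e′) → b≢d (sym (two-steps d a b (proj₂ d~a) (proj₂ a~b) e e′)))) ⟩
    2 * 2 ^ n + 2 ∎
    where
    open FourCycle C
    open ≡-Reasoning
    label≡ : ∀ (v : Vec Bool n) → suc (toℕ (fin v)) ≡ suc (value v)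
    label≡ v = cong suc (toℕ-fin v)
    lemma : ∀ a b c d → suc a + suc b + suc c + suc d ≡ a + b + c + d + 2 + 2
    lemma = solve-∀

-- Codes of magic labellings

code : ∀ {G n} → MagicLabelling G n → Vertex G → Vec Bool n
code {n = n} A v = digits n (toℕ (Bijection.to (MagicLabelling.labelling A) v))

label≡value-code : ∀ {G n} (A : MagicLabelling G n) v → label A v ≡ suc (value (code A v))
label≡value-code {n = n} A v = cong suc (sym (value-digits n (toℕ<n (Bijection.to (MagicLabelling.labelling A) v))))

label-injective : ∀ {G n} (A : MagicLabelling G n) → Injective _≡_ _≡_ (label A)
label-injective A eq = Bijection.injective (MagicLabelling.labelling A) (toℕ-injective (suc-injective eq))

code-injective : ∀ {G n} (A : MagicLabelling G n) → Injective _≡_ _≡_ (code A)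
code-injective A {u} {v} eq = label-injective A
  (trans (label≡value-code A u) (trans (cong (suc ∘ value) eq) (sym (label≡value-code A v))))

face : ∀ {n} v {i j : Fin n} → i ≢ j → FourCycle (Q n)
face v {i} {j} i≢j = record
  { a = v ; b = flip i v ; c = flip j (flip i v) ; d = flip j v
  ; a~b = flip⇒one i v
  ; b~c = flip⇒one j (flip i v)
  ; c~d = one-sym {x = flip j v} {y = flip j (flip i v)}
            (subst (DifferInExactlyOne (flip j v)) flip-comm (flip⇒one i (flip j v)))
  ; d~a = one-sym {x = v} {y = flip j v} (flip⇒one j v)
  ; a≢c = λ eq → ≢not (lookup v i) (trans (cong (λ w → lookup w i) eq)
            (trans (lookup-flip-≢ i≢j (flip i v)) (lookup-flip i v)))
  ; b≢d = λ eq → ≢not (lookup v i) (sym (trans (sym (lookup-flip i v))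
            (trans (cong (λ w → lookup w i) eq) (lookup-flip-≢ i≢j v))))
  }
  where
  flip-comm : flip i (flip j v) ≡ flip j (flip i v)
  flip-comm = lookup-ext at
    where
    at : ∀ k → lookup (flip i (flip j v)) k ≡ lookup (flip j (flip i v)) k
    at k with k ≟ᶠ i | k ≟ᶠ j
    ... | yes refl | yes refl = refl
    ... | yes refl | no k≢j   = trans (lookup-flip i (flip j v)) (trans (cong not (lookup-flip-≢ k≢j v))
            (sym (trans (lookup-flip-≢ k≢j (flip i v)) (lookup-flip i v))))
    ... | no k≢i   | yes refl = trans (lookup-flip-≢ k≢i (flip j v)) (trans (lookup-flip j v)
            (sym (trans (lookup-flip j (flip i v)) (cong not (lookup-flip-≢ k≢i v)))))
    ... | no k≢i   | no k≢j   = trans (lookup-flip-≢ k≢i (flip j v)) (trans (lookup-flip-≢ k≢j v)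
            (sym (trans (lookup-flip-≢ k≢j (flip i v)) (lookup-flip-≢ k≢i v))))

code-flip-agree : ∀ {n} (B : MagicLabelling (Q n) n) i v → AgreeAtMostOnce (code B v) (code B (flip i v))
-- For `n = 1` there are no faces to use, but a word of length 1 has only one place.
code-flip-agree {suc zero}    B i v {zero} {zero} _ _ = refl
code-flip-agree {suc (suc m)} B i v = faces⇒flip-agree 2^n≡1+M f (λ w → toℕ<n (to w))
  (λ m<2^n → from (fromℕ< m<2^n) , trans (cong toℕ (strictlyInverseˡ _)) (toℕ-fromℕ< m<2^n))
  face-sum i v
  where
  open Inverse (⤖⇒↔ (MagicLabelling.labelling B)) using (to; from; strictlyInverseˡ)
  n = suc (suc m)
  M = pred (2 ^ n)
  2^n≡1+M : 2 ^ n ≡ suc M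
  2^n≡1+M = sym (suc-pred (2 ^ n) {{m^n≢0 2 n}})
  f : Vec Bool n → ℕ
  f w = toℕ (to w)

  0≢1 : _≢_ {A = Fin n} zero (suc zero)
  0≢1 ()

  S : ℕ
  S = sumAround {Q n} f (face zeros 0≢1)

  around≡S : (C : FourCycle (Q n)) → sumAround {Q n} f C ≡ S
  -- Labels start at 1 and the values of `f` at 0, so the two sums around a cycle differ by 4.
  around≡S C = +-cancelʳ-≡ 4 _ _ (trans (sym (4-suc (f C.a) (f C.b) (f C.c) (f C.d)))
    (trans (MagicLabelling.magic B C C₀) (4-suc (f C₀.a) (f C₀.b) (f C₀.c) (f C₀.d))))
    where
    C₀ = face zeros 0≢1
    module C = FourCycle C
    module C₀ = FourCycle C₀

  S≡M+M : S ≡ M + M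
  S≡M+M = +-cancelʳ-≡ 2 _ _ (trans
    (face-constant m S (MagicLabelling.labelling B)
      (λ w → trans (rearrange (f (false ∷ false ∷ w)) _ _ _) (around≡S (face (false ∷ false ∷ w) 0≢1))))
    (trans (cong (2 *_) 2^n≡1+M) (double M)))
    where
    rearrange : ∀ x y z t → x + y + (z + t) ≡ x + y + t + z
    rearrange = solve-∀
    double : ∀ M → 2 * suc M ≡ M + M + 2
    double = solve-∀

  face-sum : ∀ v {i j} → i ≢ j → f v + f (flip i v) + f (flip j (flip i v)) + f (flip j v) ≡ M + M
  face-sum v i≢j = trans (around≡S (face v i≢j)) S≡M+M

code-edge : ∀ {n} (B : MagicLabelling (Q n) n) {x y} → Graph._~_ (Q n) x y → Graph._~_ (H n) (code B x) (code B y)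
code-edge {n} B {x} {y} x~y with i , refl ← one⇒flip {u = x} {v = y} x~y =
  (λ eq → Graph.~-irrefl (Q n) (code-injective B eq) x~y) , code-flip-agree B i x

-- Pulling labellings back along embeddings, and the classification

mapCycle : ∀ {G G′} → Embedding G G′ → FourCycle G → FourCycle G′
mapCycle φ C = record
  { a = map′ a ; b = map′ b ; c = map′ c ; d = map′ d
  ; a~b = edge a~b ; b~c = edge b~c ; c~d = edge c~d ; d~a = edge d~a
  ; a≢c = a≢c ∘ injective ; b≢d = b≢d ∘ injective
  }
  where
  open Embedding φ renaming (map to map′)
  open FourCycle C

pullback : ∀ {G G′ n} (A : MagicLabelling G n) (φ : Embedding G′ G) →
  StrictlySurjective _≡_ (Bijection.to (MagicLabelling.labelling A) ∘ Embedding.map φ) → MagicLabelling G′ n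
pullback A φ surjective = record
  { labelling = mk⤖ (Embedding.injective φ ∘ Bijection.injective (MagicLabelling.labelling A)
                    , strictlySurjective⇒surjective surjective)
  ; magic = λ C C′ → MagicLabelling.magic A (mapCycle φ C) (mapCycle φ C′)
  }

-- The embedding followed by the labelling is an injection between sets of 2ⁿ elements, hence a
-- bijection.
pullback-cube : ∀ {G n} → MagicLabelling G n → Embedding (Q n) G → MagicLabelling (Q n) n
pullback-cube {n = n} A φ = pullback A φ surjective
  where
  f = Bijection.to (MagicLabelling.labelling A) ∘ Embedding.map φ
  surjective : StrictlySurjective _≡_ f
  surjective k with j , eq ← injective⇒surjective {f = f ∘ digits n ∘ toℕ}
    (λ {i} {j} eq → trans (sym (fin-digits {n} i)) (trans (cong fin
      (Embedding.injective φ (Bijection.injective (MagicLabelling.labelling A) eq))) (fin-digits {n} j))) k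
    = digits n (toℕ j) , eq

-- Some power of an injective self-map of a finite set fixes x, so P can be
-- carried from f x on to x.
preserved⇒reflected : ∀ {X : Set} {N} {enc : X → Fin N} → Injective _≡_ _≡_ enc →
  ∀ {f : X → X} → Injective _≡_ _≡_ f → ∀ {P : X → Set} → (∀ x → P x → P (f x)) →
  ∀ x → P (f x) → P x
preserved⇒reflected {X} {N} {enc} enc-inj {f} f-inj {P} preserve x Pfx =
  let i , j , i<j , eq = pigeonhole (n<1+n N) (λ k → enc (iter (toℕ k) x))
  in subst P (sym (period (toℕ i) (toℕ j) i<j (enc-inj eq))) (carry (toℕ j ∸ suc (toℕ i)) Pfx)
  where
  iter : ℕ → X → X
  iter zero    y = y
  iter (suc k) y = f (iter k y)
  iter-f : ∀ k y → iter k (f y) ≡ f (iter k y)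
  iter-f zero    y = refl
  iter-f (suc k) y = cong f (iter-f k y)
  carry : ∀ k {y} → P y → P (iter k y)
  carry zero    Py = Py
  carry (suc k) Py = preserve _ (carry k Py)
  period : ∀ i j → i < j → iter i x ≡ iter j x → x ≡ iter (j ∸ suc i) (f x)
  period zero    (suc j) _         eq = trans eq (sym (iter-f j x))
  period (suc i) (suc j) (s≤s i<j) eq = period i j i<j (f-inj eq)

-- This carries facts about labellings of cubes over to `G`: a labelling of `G` is pulled back along
-- an embedded cube through the given edge.
Covered : Graph → ℕ → Set
Covered G n = ∀ {u v} → Graph._~_ G u v → Σ[ φ ∈ Embedding (Q n) G ] ∃[ x ] ∃[ y ]
  (Graph._~_ (Q n) x y × Embedding.map φ x ≡ u × Embedding.map φ y ≡ v)

module Classification {G n} (κ : Embedding G (H n)) (κ⁻¹ : Embedding (H n) G)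
  (κ∘κ⁻¹ : ∀ w → Embedding.map κ (Embedding.map κ⁻¹ w) ≡ w) (cover : Covered G n)
  where

  open Graph G using (_~_)
  open Graph (H n) using () renaming (_~_ to _~ᴴ_)

  code-preserves : ∀ (A : MagicLabelling G n) {u v} → u ~ v → code A u ~ᴴ code A v
  code-preserves A u~v with φ , x , y , x~y , refl , refl ← cover u~v = code-edge (pullback-cube A φ) x~y

  -- Followed by `κ⁻¹`, the code is an injective self-map of `G` preserving adjacency. On the finite
  -- set of pairs of vertices, such a map reflects adjacency too.
  code-reflects : ∀ (A : MagicLabelling G n) {u v} → code A u ~ᴴ code A v → u ~ v
  code-reflects A {u} {v} cu~cv = preserved⇒reflected {X = Vertex G × Vertex G}
    {enc = λ (x , y) → combine (to x) (to y)}
    (λ {p} {q} eq → let e , e′ = combine-injective (to (proj₁ p)) _ (to (proj₁ q)) _ eq in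
      cong₂ _,_ (injective e) (injective e′))
    {f = λ (x , y) → f x , f y}
    (λ eq → cong₂ _,_ (f-injective (cong proj₁ eq)) (f-injective (cong proj₂ eq)))
    {P = λ (x , y) → x ~ y}
    (λ _ x~y → Embedding.edge κ⁻¹ (code-preserves A x~y))
    (u , v) (Embedding.edge κ⁻¹ cu~cv)
    where
    open Bijection (MagicLabelling.labelling A) using (to; injective)
    f : Vertex G → Vertex G
    f = Embedding.map κ⁻¹ ∘ code A
    f-injective : Injective _≡_ _≡_ f
    f-injective = code-injective A ∘ Embedding.injective κ⁻¹

  canonical : MagicLabelling G n
  canonical = pullback (binaryMagic n) κ
    (λ k → Embedding.map κ⁻¹ (digits n (toℕ k)) , trans (cong fin (κ∘κ⁻¹ _)) (fin-digits {n} k))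

  -- The bijection matching equal labels also matches codes, and adjacency can be read off from the
  -- codes.
  same-orbit : ∀ (A B : MagicLabelling G n) → SameOrbit A B
  same-orbit A B = record
    { bijection = σ
    ; preserves = λ u v → mk⇔
        (λ u~v → code-reflects B (subst₂ _~ᴴ_ (sym (code-σ u)) (sym (code-σ v)) (code-preserves A u~v)))
        (λ σu~σv → code-reflects A (subst₂ _~ᴴ_ (code-σ u) (code-σ v) (code-preserves B σu~σv)))
    } , (λ v → cong (suc ∘ toℕ) (to-σ v))
    where
    module A = Inverse (⤖⇒↔ (MagicLabelling.labelling A))
    module B = Inverse (⤖⇒↔ (MagicLabelling.labelling B))
    σ : Vertex G ⤖ Vertex G
    σ = ⤖-trans (MagicLabelling.labelling A) (sym-≡ (MagicLabelling.labelling B))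
    to-σ : ∀ v → B.to (Bijection.to σ v) ≡ A.to v
    to-σ v = B.strictlyInverseˡ (A.to v)
    code-σ : ∀ v → code B (Bijection.to σ v) ≡ code A v
    code-σ v = cong (digits n ∘ toℕ) (to-σ v)

  existsUnique : ExistsUniqueUpToAut G n
  existsUnique = canonical , same-orbit canonical

  -- The embedding belonging to `B` sends a vertex to the one with the same label under `A`. It
  -- preserves edges because `B` has adjacent codes along edges of the cube and the code of `A`
  -- reflects adjacency.
  correspondence : (A : MagicLabelling G n) → EmbeddingCorrespondence G n A
  correspondence A = record
    { to        = pullback-cube A
    ; cong      = λ φ≡ψ v → cong (label A) (φ≡ψ v)
    ; bijective = (λ eq v → label-injective A (eq v))
                , (λ B → embedding B , λ φ≡ v → trans (cong (label A) (φ≡ v)) (label-embedding B v))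
    } , (λ _ _ → refl)
    where
    module A = Inverse (⤖⇒↔ (MagicLabelling.labelling A))
    module _ (B : MagicLabelling (Q n) n) where
      module B = Inverse (⤖⇒↔ (MagicLabelling.labelling B))
      to-from : ∀ v → A.to (A.from (B.to v)) ≡ B.to v
      to-from v = A.strictlyInverseˡ (B.to v)
      embedding : Embedding (Q n) G
      embedding = record
        { map       = λ v → A.from (B.to v)
        ; injective = λ {u} {v} eq → Bijection.injective (MagicLabelling.labelling B)
            (trans (sym (to-from u)) (trans (cong A.to eq) (to-from v)))
        ; edge      = λ {u} {v} u~v → code-reflects A (subst₂ _~ᴴ_
            (cong (digits n ∘ toℕ) (sym (to-from u))) (cong (digits n ∘ toℕ) (sym (to-from v)))
            (code-edge B u~v))
        }
      label-embedding : ∀ v → label A (Embedding.map embedding v) ≡ label B v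
      label-embedding v = cong (suc ∘ toℕ) (to-from v)

-- Folded and hierarchical folded hypercubes

∣⇒odd-false : ∀ {n} → 2 ∣ n → odd n ≡ false
∣⇒odd-false (divides q refl) = trans (cong odd (*-comm q 2)) (odd-2* q)

odd-false⇒∣ : ∀ n → odd n ≡ false → 2 ∣ n
odd-false⇒∣ n even = divides ⌊ n /2⌋ (trans (parity-split n)
  (trans (cong (λ b → weigh b 1 + 2 * ⌊ n /2⌋) even) (*-comm 2 ⌊ n /2⌋)))

∤suc⇒odd-false : ∀ {m} → 2 ∤ suc m → odd m ≡ false
∤suc⇒odd-false {m} 2∤1+m with odd m in eq
... | false = refl
... | true  = contradiction (odd-false⇒∣ (suc m) (cong not eq)) 2∤1+m

-- Complementing words

xor-cancelˡ : ∀ b c → b xor (b xor c) ≡ c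
xor-cancelˡ true  c = not-involutive c
xor-cancelˡ false c = refl

xor-injective : ∀ b {c d} → b xor c ≡ b xor d → c ≡ d
xor-injective b eq = trans (sym (xor-cancelˡ b _)) (trans (cong (b xor_) eq) (xor-cancelˡ b _))

translate : ∀ {n} → Bool → Vec Bool n → Vec Bool n
translate b = map (b xor_)

lookup-translate : ∀ {n} b (v : Vec Bool n) i → lookup (translate b v) i ≡ b xor lookup v i
lookup-translate b v i = lookup-map i (b xor_) v

translate-involutive : ∀ {n} b (v : Vec Bool n) → translate b (translate b v) ≡ v
translate-involutive b v = lookup-ext λ i → trans (lookup-translate b (translate b v) i)
  (trans (cong (b xor_) (lookup-translate b v i)) (xor-cancelˡ b _))

translate-injective : ∀ {n} b → Injective _≡_ _≡_ (translate {n} b)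
translate-injective b eq = trans (sym (translate-involutive b _))
  (trans (cong (translate b) eq) (translate-involutive b _))

translate-same : ∀ {n} b (u v : Vec Bool n) i →
  lookup (translate b u) i ≡ lookup (translate b v) i → lookup u i ≡ lookup v i
translate-same b u v i eq = xor-injective b
  (trans (sym (lookup-translate b u i)) (trans eq (lookup-translate b v i)))

translate-opposite : ∀ {n} b (u v : Vec Bool n) i →
  lookup (translate b u) i ≡ lookup (translate (not b) v) i → lookup u i ≢ lookup v i
translate-opposite b u v i eq uᵢ≡vᵢ = ≢not (b xor lookup u i) (begin
  b xor lookup u i              ≡⟨ lookup-translate b u i ⟨
  lookup (translate b u) i      ≡⟨ eq ⟩
  lookup (translate (not b) v) i ≡⟨ lookup-translate (not b) v i ⟩
  not b xor lookup v i          ≡⟨ not-distribˡ-xor b (lookup v i) ⟨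
  not (b xor lookup v i)        ≡⟨ cong (not ∘ (b xor_)) uᵢ≡vᵢ ⟨
  not (b xor lookup u i)        ∎)
  where open ≡-Reasoning

translate-opposite⁻¹ : ∀ {n} b (u v : Vec Bool n) i →
  lookup u i ≢ lookup v i → lookup (translate b u) i ≡ lookup (translate (not b) v) i
translate-opposite⁻¹ b u v i uᵢ≢vᵢ = begin
  lookup (translate b u) i       ≡⟨ lookup-translate b u i ⟩
  b xor lookup u i               ≡⟨ cong (b xor_) (≡not (≢-sym uᵢ≢vᵢ)) ⟩
  b xor not (lookup v i)         ≡⟨ not-distribʳ-xor b (lookup v i) ⟨
  not (b xor lookup v i)         ≡⟨ not-distribˡ-xor b (lookup v i) ⟩
  not b xor lookup v i           ≡⟨ lookup-translate (not b) v i ⟨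
  lookup (translate (not b) v) i ∎
  where open ≡-Reasoning

parity-complement : ∀ {n} (v : Vec Bool n) → parity (map not v) ≡ odd n xor parity v
parity-complement []              = refl
parity-complement {suc n} (b ∷ v) = begin
  not b xor parity (map not v)    ≡⟨ cong (not b xor_) (parity-complement v) ⟩
  not b xor (odd n xor parity v)  ≡⟨ lemma b (odd n) (parity v) ⟩
  not (odd n) xor (b xor parity v) ∎
  where
  open ≡-Reasoning
  lemma : ∀ b c d → not b xor (c xor d) ≡ not c xor (b xor d)
  lemma true  true  d = refl
  lemma true  false d = sym (not-involutive d)
  lemma false true  d = not-involutive d
  lemma false false d = refl

antipodal⇒complement : ∀ {n} (u v : Vec Bool n) → Antipodal u v → v ≡ map not u
antipodal⇒complement u v antipodal =
  lookup-ext λ i → trans (≡not (antipodal i)) (sym (lookup-map i not u))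

one⇒parity : ∀ {n} {u v : Vec Bool n} → DifferInExactlyOne u v → parity v ≡ not (parity u)
one⇒parity {u = u} {v} one with i , refl ← one⇒flip {u = u} {v} one = parity-flip i u

-- Complementing exactly one of two words exchanges agreement and disagreement at every place.
opposite-one : ∀ {n} b (u v : Vec Bool n) {i} → AgreeAtMostOnce u v → lookup u i ≡ lookup v i →
  DifferInExactlyOne (translate b u) (translate (not b) v)
opposite-one b u v {i} agree eq = i , (λ e → translate-opposite b u v i e eq) , unique
  where
  unique : ∀ {j} → lookup (translate b u) j ≢ lookup (translate (not b) v) j → i ≡ j
  unique {j} differ with lookup u j ≟ᵇ lookup v j
  ... | yes eq′ = agree eq eq′
  ... | no ≢′   = contradiction (translate-opposite⁻¹ b u v j ≢′) differ

-- For n even, complementing the odd vertices of FQ n exchanges adjacency in one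
-- coordinate with agreement in one coordinate.
module Even {n} (even : odd n ≡ false) where

  parity-translate : ∀ b (v : Vec Bool n) → parity (translate b v) ≡ parity v
  parity-translate false v = cong parity (map-id v)
  parity-translate true  v = trans (parity-complement v) (cong (_xor parity v) even)

  -- Parity tells the two kinds of edges of `H n` apart: for even `n`, complementing a word keeps
  -- its parity, and one further flip changes it.
  data Agreement (u v : Vec Bool n) : Set where
    nowhere : Antipodal u v → parity v ≡ parity u → Agreement u v
    once    : ∀ i → lookup u i ≡ lookup v i → parity v ≡ not (parity u) → Agreement u v

  antipodal⇒parity : ∀ u v → Antipodal u v → parity v ≡ parity u
  antipodal⇒parity u v antipodal =
    trans (cong parity (antipodal⇒complement u v antipodal)) (parity-translate true u)

  agreement : ∀ u v → AgreeAtMostOnce u v → Agreement u v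
  agreement u v agree with any? (λ i → lookup u i ≟ᵇ lookup v i)
  ... | no none        = let antipodal = λ i eq → none (i , eq) in
                         nowhere antipodal (antipodal⇒parity u v antipodal)
  ... | yes (i , uᵢ≡vᵢ) = once i uᵢ≡vᵢ (begin
    parity v                        ≡⟨ parity-translate true v ⟨
    parity (translate true v)       ≡⟨ one⇒parity {u = translate false u} {v = translate true v}
                                         (opposite-one false u v agree uᵢ≡vᵢ) ⟩
    not (parity (translate false u)) ≡⟨ cong not (parity-translate false u) ⟩
    not (parity u)                  ∎)
    where open ≡-Reasoning

  translate-antipodal : ∀ b (u v : Vec Bool n) → Antipodal u v → Antipodal (translate b u) (translate b v)
  translate-antipodal b u v antipodal i = antipodal i ∘ translate-same b u v i

  fold : Vec Bool n → Vec Bool n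
  fold v = translate (parity v) v

  fold-involutive : ∀ v → fold (fold v) ≡ v
  fold-involutive v = trans
    (cong (λ b → translate b (fold v)) (parity-translate (parity v) v))
    (translate-involutive (parity v) v)

  fold-injective : Injective _≡_ _≡_ fold
  fold-injective eq = trans (sym (fold-involutive _)) (trans (cong fold eq) (fold-involutive _))

  FQ→H : Embedding (FQ n) (H n)
  FQ→H = record { map = fold ; injective = fold-injective ; edge = edge }
    where
    edge : ∀ {u v} → Graph._~_ (FQ n) u v → Graph._~_ (H n) (fold u) (fold v)
    edge {u} {v} u~v = (λ eq → Graph.~-irrefl (FQ n) (fold-injective eq) u~v) , agree u~v
      where
      agree : Graph._~_ (FQ n) u v → AgreeAtMostOnce (fold u) (fold v)
      agree (inj₁ one@(_ , _ , unique)) {i} {j} eq eq′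
        rewrite one⇒parity {u = u} {v = v} one =
        trans (sym (unique (translate-opposite (parity u) u v i eq)))
          (unique (translate-opposite (parity u) u v j eq′))
      agree (inj₂ (_ , antipodal)) {i} eq
        rewrite antipodal⇒parity u v antipodal =
        contradiction (translate-same (parity u) u v i eq) (antipodal i)

  H→FQ : Embedding (H n) (FQ n)
  H→FQ = record { map = fold ; injective = fold-injective ; edge = λ {u} {v} → edge u v }
    where
    edge : ∀ u v → Graph._~_ (H n) u v → Graph._~_ (FQ n) (fold u) (fold v)
    edge u v (u≢v , agree) with agreement u v agree
    ... | nowhere antipodal p = inj₂ (u≢v ∘ fold-injective ,
      subst (λ q → Antipodal (fold u) (translate q v)) (sym p) (translate-antipodal (parity u) u v antipodal))
    ... | once i uᵢ≡vᵢ p = inj₁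
      (subst (λ q → DifferInExactlyOne (fold u) (translate q v)) (sym p) (opposite-one (parity u) u v agree uᵢ≡vᵢ))

  -- Each kind of edge becomes an edge of `H (suc n)`: a step in `K₂` changes every digit, a single
  -- flip changes all but the digit of the flipped coordinate, and an antipodal step changes all but
  -- the leading digit.
  unfold : Bool × Vec Bool n → Vec Bool (suc n)
  unfold (b , x) = (b xor parity x) ∷ translate (b xor parity x) x

  refold : Vec Bool (suc n) → Bool × Vec Bool n
  refold (c ∷ y) = c xor parity y , translate c y

  unfold-refold : ∀ w → unfold (refold w) ≡ w
  unfold-refold (c ∷ y)
    rewrite parity-translate c y | xor-cancelʳ c (parity y) = cong (c ∷_) (translate-involutive c y)

  refold-unfold : ∀ p → refold (unfold p) ≡ p
  refold-unfold (b , x) = cong₂ _,_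
    (trans (cong (c xor_) (parity-translate c x)) (xor-cancelʳ b (parity x)))
    (translate-involutive c x)
    where
    c = b xor parity x

  unfold-injective : Injective _≡_ _≡_ unfold
  unfold-injective eq = trans (sym (refold-unfold _)) (trans (cong refold eq) (refold-unfold _))

  refold-injective : Injective _≡_ _≡_ refold
  refold-injective eq = trans (sym (unfold-refold _)) (trans (cong unfold eq) (unfold-refold _))

  HFQ→H : Embedding (K₂ □ FQ n) (H (suc n))
  HFQ→H = record { map = unfold ; injective = unfold-injective ; edge = edge }
    where
    opposite : ∀ c (x y : Vec Bool n) →
      (∀ {i j} → lookup x i ≢ lookup y i → lookup x j ≢ lookup y j → i ≡ j) →
      AgreeAtMostOnce (c ∷ translate c x) (not c ∷ translate (not c) y)
    opposite c x y unique {zero}          eq _   = contradiction eq (≢not c)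
    opposite c x y unique {suc i} {zero}  _  eq  = contradiction eq (≢not c)
    opposite c x y unique {suc i} {suc j} eq eq′ = cong suc
      (unique (translate-opposite c x y i eq) (translate-opposite c x y j eq′))

    agree : ∀ {p q} → Graph._~_ (K₂ □ FQ n) p q → AgreeAtMostOnce (unfold p) (unfold q)
    agree {b , x} (inj₁ (b≢b′ , refl)) {i} {j}
      rewrite ≡not b≢b′ | sym (not-distribˡ-xor b (parity x)) =
      opposite (b xor parity x) x x (λ x≢x → contradiction refl x≢x) {i} {j}
    agree {b , x} {_ , y} (inj₂ (refl , inj₁ one@(_ , _ , unique))) {i} {j}
      rewrite one⇒parity {u = x} {v = y} one | sym (not-distribʳ-xor b (parity x)) =
      opposite (b xor parity x) x y (λ d d′ → trans (sym (unique d)) (unique d′)) {i} {j}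
    agree {b , x} {_ , y} (inj₂ (refl , inj₂ (_ , antipodal))) {i} {j} eq eq′
      rewrite antipodal⇒parity x y antipodal = trans (at-zero i eq) (sym (at-zero j eq′))
      where
      c = b xor parity x
      at-zero : ∀ i → lookup (c ∷ translate c x) i ≡ lookup (c ∷ translate c y) i → i ≡ zero
      at-zero zero    _  = refl
      at-zero (suc i) eq = contradiction (translate-same c x y i eq) (antipodal i)

    edge : ∀ {p q} → Graph._~_ (K₂ □ FQ n) p q → Graph._~_ (H (suc n)) (unfold p) (unfold q)
    edge p~q = (λ eq → Graph.~-irrefl (K₂ □ FQ n) (unfold-injective eq) p~q) , agree p~q

  H→HFQ : Embedding (H (suc n)) (K₂ □ FQ n)
  H→HFQ = record { map = refold ; injective = refold-injective ; edge = λ {u} {v} → edge u v }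
    where
    edge : ∀ u v → Graph._~_ (H (suc n)) u v → Graph._~_ (K₂ □ FQ n) (refold u) (refold v)
    edge (c ∷ y) (d ∷ z) (u≢v , agree) with c ≟ᵇ d
    -- The leading digit is the one permitted agreement, so the tails are antipodal.
    ... | yes refl = inj₂ (cong (c xor_) (sym (antipodal⇒parity y z antipodal)) ,
                           inj₂ (u≢v ∘ cong (c ∷_) ∘ translate-injective c , translate-antipodal c y z antipodal))
      where
      antipodal : Antipodal y z
      antipodal i eq with () ← agree {zero} {suc i} refl eq
    ... | no c≢d rewrite ≡not c≢d with agreement y z (λ eq eq′ → sucᶠ-injective (agree eq eq′))
    ...   | nowhere antipodal p = inj₁
      ( (λ eq → ≢not (c xor parity y) (trans eq (trans (cong (not c xor_) p) (sym (not-distribˡ-xor c (parity y))))))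
      , lookup-ext (λ i → translate-opposite⁻¹ c y z i (antipodal i)))
    ...   | once i yᵢ≡zᵢ p = inj₂
      ( (begin
          c xor parity y              ≡⟨ not-involutive (c xor parity y) ⟨
          not (not (c xor parity y))  ≡⟨ cong not (not-distribʳ-xor c (parity y)) ⟩
          not (c xor not (parity y))  ≡⟨ not-distribˡ-xor c (not (parity y)) ⟩
          not c xor not (parity y)    ≡⟨ cong (not c xor_) p ⟨
          not c xor parity z          ∎)
      , inj₁ (opposite-one c y z (λ eq eq′ → sucᶠ-injective (agree eq eq′)) yᵢ≡zᵢ))
      where open ≡-Reasoning

-- Embedded cubes through every edge

Q⊆FQ : ∀ {n} → Embedding (Q n) (FQ n)
Q⊆FQ = record { map = λ v → v ; injective = λ eq → eq ; edge = inj₁ }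

-- Sends the first unit vector to the antipodal generator and fixes the others.
shear : ∀ {n} → Embedding (Q (suc n)) (FQ (suc n))
shear {n} = record { map = to ; injective = λ {u} {v} → to-injective u v ; edge = λ {u} {v} → edge u v }
  where
  to : Vec Bool (suc n) → Vec Bool (suc n)
  to (b ∷ w) = b ∷ translate b w
  to-injective : ∀ u v → to u ≡ to v → u ≡ v
  to-injective (b ∷ u) (c ∷ v) eq with refl , eq′ ← ∷-injective eq = cong (b ∷_) (translate-injective b eq′)
  translate-flip : ∀ {n} b i (v : Vec Bool n) → translate b (flip i v) ≡ flip i (translate b v)
  translate-flip b zero    (c ∷ v) = cong (_∷ translate b v) (sym (not-distribʳ-xor b c))
  translate-flip b (suc i) (c ∷ v) = cong ((b xor c) ∷_) (translate-flip b i v)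
  edge : ∀ u v → DifferInExactlyOne u v → Graph._~_ (FQ (suc n)) (to u) (to v)
  edge (b ∷ w) v one with one⇒flip {u = b ∷ w} {v = v} one
  ... | zero  , refl = inj₂ ((λ eq → ≢not b (proj₁ (∷-injective eq))) , λ where
    zero    → ≢not b
    (suc i) → λ eq → translate-opposite b w w i eq refl)
  ... | suc i , refl = inj₁ (subst (DifferInExactlyOne (to (b ∷ w)))
    (cong (b ∷_) (sym (translate-flip b i w))) (flip⇒one (suc i) (to (b ∷ w))))

FQ-covered : ∀ {n} → Covered (FQ n) n
FQ-covered {n}     {u}     {v} (inj₁ one) = Q⊆FQ , u , v , one , refl , refl
FQ-covered {zero}  {[]}    {[]} (inj₂ ([]≢[] , _)) = contradiction refl []≢[]
FQ-covered {suc n} {b ∷ u} {v}  (inj₂ (_ , antipodal)) =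
  -- The map of `shear` is an involution, so the preimage of `b ∷ u` is its image; flipping the
  -- first coordinate there complements all of `b ∷ u`.
  shear , b ∷ translate b u , flip zero (b ∷ translate b u) , flip⇒one zero (b ∷ translate b u) ,
  cong (b ∷_) (translate-involutive b u) ,
  trans (cong (not b ∷_) (lookup-ext λ i → trans (lookup-translate (not b) (translate b u) i)
      (trans (sym (not-distribˡ-xor b _)) (trans (cong not (trans (cong (b xor_) (lookup-translate b u i))
        (xor-cancelˡ b _))) (sym (lookup-map i not u))))))
    (sym (antipodal⇒complement (b ∷ u) v antipodal))

slice : ∀ {n} {G : Graph} → Embedding (Q n) G → Embedding (Q (suc n)) (K₂ □ G)
slice {n} {G} φ = record { map = to ; injective = λ {u} {v} → to-injective u v ; edge = λ {u} {v} → edge u v }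
  where
  to : Vec Bool (suc n) → Bool × Vertex G
  to (b ∷ x) = b , Embedding.map φ x
  to-injective : ∀ u v → to u ≡ to v → u ≡ v
  to-injective (b ∷ x) (c ∷ y) eq = cong₂ _∷_ (cong proj₁ eq) (Embedding.injective φ (cong proj₂ eq))
  edge : ∀ u v → DifferInExactlyOne u v → Graph._~_ (K₂ □ G) (to u) (to v)
  edge (b ∷ x) v one with one⇒flip {u = b ∷ x} {v = v} one
  ... | zero  , refl = inj₁ (≢not b , refl)
  ... | suc i , refl = inj₂ (refl , Embedding.edge φ (flip⇒one i x))

HFQ-covered : ∀ {m} → Covered (K₂ □ FQ m) (suc m)
HFQ-covered {u = b , x} (inj₁ (b≢c , refl)) = slice Q⊆FQ , b ∷ x , not b ∷ x ,
  flip⇒one zero (b ∷ x) , refl , cong (_, x) (sym (≡not b≢c))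
HFQ-covered {u = b , x} (inj₂ (refl , x~y)) with φ , s , t , s~t , refl , refl ← FQ-covered x~y
  with i , refl ← one⇒flip {u = s} {v = t} s~t =
  slice φ , b ∷ s , b ∷ t , flip⇒one (suc i) (b ∷ s) , refl , refl

theorem3 : (∀ (n : ℕ) → 2 ∣ n →
    ExistsUniqueUpToAut (FQ n) n
    × (∀ (A : MagicLabelling (FQ n) n) → EmbeddingCorrespondence (FQ n) n A))
    × (∀ (n : ℕ) .{{_ : NonZero n}} → 2 ∤ n →
    ExistsUniqueUpToAut (HFQ n) n
    × (∀ (A : MagicLabelling (HFQ n) n) → EmbeddingCorrespondence (HFQ n) n A))
theorem3 =
    (λ n 2∣n → let open Even {n} (∣⇒odd-false 2∣n)
                   open Classification FQ→H H→FQ fold-involutive FQ-covered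
               in existsUnique , correspondence)
  -- The factor `FQ m` of `HFQ (suc m)` has even dimension, so `Even` applies to it.
  , λ { (suc m) 2∤n → let open Even {m} (∤suc⇒odd-false 2∤n)
                          open Classification HFQ→H H→HFQ unfold-refold HFQ-covered
                      in existsUnique , correspondence }
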